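{- Let $f(\mathbf{x}) \in \mathbb{C}[\mathbf{x}]$ be a polynomial that is set-multilinear with respect to a partition $\mathbf{x} = \mathbf{x}_1 \sqcup \cdots \sqcup \mathbf{x}_d$ of its variables. Then the smallest width of a commutative set-multilinear ABP (with respect to this partition) computing $f$ is at most $\mathrm{DPD}(f)$.
   Context: A polynomial is set-multilinear with respect to a partition $\mathbf{x} = \mathbf{x}_1\sqcup\cdots\sqcup\mathbf{x}_d$ if each of its monomials contains exactly one variable from each part $\mathbf{x}_j$ (with degree one). Write $\mathbf{x}_j = \{x_{j,1},\ldots,x_{j,|\mathbf{x}_j|}\}$. A set-multilinear ABP (smABP) of width $w$ computing $f$ consists of a permutation $\sigma$ of $[d]$, matrices $A_{j,k}\in\mathbb{C}^{w\times w}$ for $j\in[d]$, $1\le k\le |\mathbf{x}_j|$, and vectors $\mathbf{u},\mathbf{v}\in\mathbb{C}^w$ such that $f(\mathbf{x}) = \mathbf{u}^T M_{\sigma(1)}(\mathbf{x}_{\sigma(1)})\cdots M_{\sigma(d)}(\mathbf{x}_{\sigma(d)})\mathbf{v}$, where $M_j(\mathbf{x}_j) = \sum_{k=1}^{|\mathbf{x}_j|} A_{j,k} x_{j,k}$; the $A_{j,k}$ are its coefficient matrices. A commutative smABP is one whose coefficient matrices all pairwise commute. For $f \in \mathbb{C}[\mathbf{x}]$, $\mathrm{DPD}(f) := \dim_{\mathbb{C}}\mathrm{span}_{\mathbb{C}}\{\partial_{\mathbf{e}} f : \mathbf{e}\}$ is the dimension of the span of all partial derivatives of $f$ of all orders (including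 $f$ itself), where $\partial_{\mathbf{e}} f$ is the partial derivative with respect to the monomial $\mathbf{x}^{\mathbf{e}}$. -}

module Defs where

open import Level using (Level; 0ℓ; _⊔_)
open import Algebra.Bundles using (CommutativeRing; RawSemiring; Semiring)
import Algebra.Solver.Ring.NaturalCoefficients.Default as NaturalCoefficients
open import Data.Bool.Base using (if_then_else_)
open import Data.Nat.Base as ℕ using (ℕ; zero; suc)
import Data.Nat.Properties as ℕ
open import Data.Fin.Base using (Fin)
import Data.Fin.Properties as Fin
open import Data.Fin.Permutation using (Permutation′; _⟨$⟩ʳ_)
open import Data.List.Base as List using (List; []; _∷_; _++_; allFin)
import Data.Vec.Functional as Vector
open import Data.Rational.Base as ℚ using (ℚ; 0ℚ; 1ℚ; ½; ∣_∣; _<_)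
import Data.Rational.Properties as ℚ
import Data.Rational.Solver as ℚSolver
open import Data.Product.Base using (Σ; ∃-syntax; _×_; _,_)
import Data.Product.Properties as Product
open import Function.Base using (_∘_)
open import Relation.Binary.PropositionalEquality.Core
  using (_≡_; _≢_; refl; sym; trans; cong; subst)
open import Relation.Binary.Definitions using (DecidableEquality)
open import Relation.Nullary.Decidable.Core using (Dec; does; map′)
open import Relation.Nullary.Negation.Core using (¬_)

------------------------------------------------------------------------
-- The real numbers: Cauchy sequences of rationals (with a modulus of
-- convergence), two of them being equal when they differ by a null
-- sequence.

Cauchy : (ℕ → ℚ) → Set
Cauchy s = ∀ ε → 0ℚ < ε →
  ∃[ N ] ∀ i j → N ℕ.≤ i → N ℕ.≤ j → ∣ s i ℚ.- s j ∣ < ε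

Null : (ℕ → ℚ) → Set
Null s = ∀ ε → 0ℚ < ε → ∃[ N ] ∀ i → N ℕ.≤ i → ∣ s i ∣ < ε

record ℝ : Set where
  constructor mkℝ
  field
    seq    : ℕ → ℚ
    cauchy : Cauchy seq

open ℝ public

infix  4 _≈ᴿ_
infixl 6 _+ᴿ_
infixl 7 _*ᴿ_
infix  8 -ᴿ_

-- A record, so that x and y can be recovered from the type x ≈ᴿ y.
record _≈ᴿ_ (x y : ℝ) : Set where
  constructor mk≈
  field null : Null (λ i → seq x i ℚ.- seq y i)

open _≈ᴿ_ public

private
  module ℚ-Solve = ℚSolver.+-*-Solver

  half : ℚ → ℚ
  half ε = ½ ℚ.* ε

  half-pos : ∀ {ε} → 0ℚ < ε → 0ℚ < half ε
  half-pos {ε} 0<ε =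
    subst (_< half ε) (ℚ.*-zeroʳ ½) (ℚ.*-monoʳ-<-pos ½ 0<ε)

  half+half : ∀ ε → half ε ℚ.+ half ε ≡ ε
  half+half ε =
    trans (sym (ℚ.*-distribʳ-+ ε ½ ½)) (ℚ.*-identityˡ ε)

  +-small : ∀ {ε} a b → ∣ a ∣ < half ε → ∣ b ∣ < half ε → ∣ a ℚ.+ b ∣ < ε
  +-small {ε} a b a< b< =
    ℚ.≤-<-trans (ℚ.∣p+q∣≤∣p∣+∣q∣ a b)
      (subst (∣ a ∣ ℚ.+ ∣ b ∣ <_) (half+half ε) (ℚ.+-mono-< a< b<))

  over : (B : ℚ) → 0ℚ < B → ℚ → ℚ
  over B 0<B ε = ε ℚ.* (ℚ.1/ B) {{ℚ.pos⇒nonZero B {{ℚ.positive 0<B}}}}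

  over-pos : ∀ B 0<B {ε} → 0ℚ < ε → 0ℚ < over B 0<B ε
  over-pos B 0<B {ε} 0<ε = ℚ.positive⁻¹ _
    {{ℚ.pos*pos⇒pos ε {{ℚ.positive 0<ε}} _
        {{ℚ.1/pos⇒pos B {{ℚ.positive 0<B}}}}}}

  *-over : ∀ B 0<B ε → B ℚ.* over B 0<B ε ≡ ε
  *-over B 0<B ε =
    trans (ℚ-Solve.solve 3 (λ b e i → b :* (e :* i) := e :* (b :* i)) refl
             B ε ((ℚ.1/ B) {{nz}}))
    (trans (cong (ε ℚ.*_) (ℚ.*-inverseʳ B {{nz}})) (ℚ.*-identityʳ ε))
    where
    open ℚ-Solve
    nz = ℚ.pos⇒nonZero B {{ℚ.positive 0<B}}

  *-small : ∀ B 0<B {ε} x a →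
            ∣ x ∣ < B → ∣ a ∣ < over B 0<B ε → ∣ x ℚ.* a ∣ < ε
  *-small B 0<B {ε} x a x< a< =
    subst (_< ε) (sym (ℚ.∣p*q∣≡∣p∣*∣q∣ x a))
      (ℚ.≤-<-trans
        (ℚ.*-monoʳ-≤-nonNeg ∣ a ∣ {{ℚ.∣-∣-nonNeg a}} (ℚ.<⇒≤ x<))
        (subst (B ℚ.* ∣ a ∣ <_) (*-over B 0<B ε)
          (ℚ.*-monoʳ-<-pos B {{ℚ.positive 0<B}} a<)))

  0<1 : 0ℚ < 1ℚ
  0<1 = ℚ.positive⁻¹ 1ℚ

  bounded : ∀ {s} → Cauchy s →
            ∃[ B ] 0ℚ < B × ∃[ N ] ∀ i → N ℕ.≤ i → ∣ s i ∣ < B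
  bounded {s} c with c 1ℚ 0<1
  ... | N , close = B , 0<B , N , below
    where
    B = 1ℚ ℚ.+ ∣ s N ∣
    0<B : 0ℚ < B
    0<B = ℚ.+-mono-<-≤ 0<1 (ℚ.0≤∣p∣ (s N))
    below : ∀ i → N ℕ.≤ i → ∣ s i ∣ < B
    below i N≤i =
      subst (λ z → ∣ z ∣ < B)
        (ℚ-Solve.solve 2 (λ a b → (a :- b) :+ b := a) refl (s i) (s N))
        (ℚ.≤-<-trans (ℚ.∣p+q∣≤∣p∣+∣q∣ (s i ℚ.- s N) (s N))
          (ℚ.+-monoˡ-< ∣ s N ∣ (close i N N≤i ℕ.≤-refl)))
      where open ℚ-Solve

  ⊔ˡ : ∀ {a b i} → a ℕ.⊔ b ℕ.≤ i → a ℕ.≤ i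
  ⊔ˡ {a} {b} = ℕ.≤-trans (ℕ.m≤m⊔n a b)

  ⊔ʳ : ∀ {a b i} → a ℕ.⊔ b ℕ.≤ i → b ℕ.≤ i
  ⊔ʳ {a} {b} = ℕ.≤-trans (ℕ.m≤n⊔m a b)

  swap-small : ∀ {ε} a b → ∣ a ℚ.- b ∣ < ε → ∣ b ℚ.- a ∣ < ε
  swap-small {ε} a b = subst (_< ε)
    (trans (sym (ℚ.∣-p∣≡∣p∣ (a ℚ.- b)))
      (cong ∣_∣ (ℚ-Solve.solve 2 (λ a b → :- (a :- b) := b :- a) refl a b)))
    where open ℚ-Solve

  +-split : ∀ a b a′ b′ →
            (a ℚ.- a′) ℚ.+ (b ℚ.- b′) ≡ (a ℚ.+ b) ℚ.- (a′ ℚ.+ b′)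
  +-split = ℚ-Solve.solve 4
    (λ a b a′ b′ → (a :- a′) :+ (b :- b′) := (a :+ b) :- (a′ :+ b′)) refl
    where open ℚ-Solve

  *-split : ∀ a b a′ b′ →
            a ℚ.* (b ℚ.- b′) ℚ.+ b′ ℚ.* (a ℚ.- a′) ≡ a ℚ.* b ℚ.- a′ ℚ.* b′
  *-split = ℚ-Solve.solve 4
    (λ a b a′ b′ → a :* (b :- b′) :+ b′ :* (a :- a′) := a :* b :- a′ :* b′)
    refl
    where open ℚ-Solve

  neg-split : ∀ a b → b ℚ.- a ≡ (ℚ.- a) ℚ.- (ℚ.- b)
  neg-split = ℚ-Solve.solve 2 (λ a b → b :- a := (:- a) :- (:- b)) refl
    where open ℚ-Solve

  *-close : ∀ {ε} Bx 0<Bx By 0<By a b a′ b′ → ∣ a ∣ < Bx → ∣ b′ ∣ < By →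
            ∣ a ℚ.- a′ ∣ < over By 0<By (half ε) →
            ∣ b ℚ.- b′ ∣ < over Bx 0<Bx (half ε) →
            ∣ a ℚ.* b ℚ.- a′ ℚ.* b′ ∣ < ε
  *-close {ε} Bx 0<Bx By 0<By a b a′ b′ a< b′< da db =
    subst (λ z → ∣ z ∣ < ε) (*-split a b a′ b′)
      (+-small (a ℚ.* (b ℚ.- b′)) (b′ ℚ.* (a ℚ.- a′))
        (*-small Bx 0<Bx a (b ℚ.- b′) a< db)
        (*-small By 0<By b′ (a ℚ.- a′) b′< da))

  const-cauchy : ∀ q → Cauchy (λ _ → q)
  const-cauchy q ε 0<ε =
    0 , λ _ _ _ _ → subst (λ z → ∣ z ∣ < ε) (sym (ℚ.+-inverseʳ q)) 0<ε

  +-cauchy : ∀ {s t} → Cauchy s → Cauchy t → Cauchy (λ i → s i ℚ.+ t i)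
  +-cauchy {s} {t} cs ct ε 0<ε =
    let N , p = cs (half ε) (half-pos 0<ε)
        M , q = ct (half ε) (half-pos 0<ε)
    in N ℕ.⊔ M , λ i j li lj →
      subst (λ z → ∣ z ∣ < ε) (+-split (s i) (t i) (s j) (t j))
        (+-small _ _ (p i j (⊔ˡ li) (⊔ˡ lj)) (q i j (⊔ʳ {N} li) (⊔ʳ {N} lj)))

  neg-cauchy : ∀ {s} → Cauchy s → Cauchy (λ i → ℚ.- s i)
  neg-cauchy {s} cs ε 0<ε with cs ε 0<ε
  ... | N , p = N , λ i j li lj →
    subst (λ z → ∣ z ∣ < ε) (neg-split (s i) (s j)) (p j i lj li)

  *-cauchy : ∀ {s t} → Cauchy s → Cauchy t → Cauchy (λ i → s i ℚ.* t i)
  *-cauchy {s} {t} cs ct ε 0<ε =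
    let Bs , 0<Bs , Ns , s< = bounded {s} cs
        Bt , 0<Bt , Nt , t< = bounded {t} ct
        N , p = cs (over Bt 0<Bt (half ε)) (over-pos Bt 0<Bt (half-pos 0<ε))
        M , q = ct (over Bs 0<Bs (half ε)) (over-pos Bs 0<Bs (half-pos 0<ε))
    in (Ns ℕ.⊔ Nt) ℕ.⊔ (N ℕ.⊔ M) , λ i j li lj →
      *-close Bs 0<Bs Bt 0<Bt (s i) (t i) (s j) (t j)
        (s< i (⊔ˡ (⊔ˡ li))) (t< j (⊔ʳ {Ns} (⊔ˡ lj)))
        (p i j (⊔ˡ (⊔ʳ {Ns ℕ.⊔ Nt} li)) (⊔ˡ (⊔ʳ {Ns ℕ.⊔ Nt} lj)))
        (q i j (⊔ʳ {N} (⊔ʳ {Ns ℕ.⊔ Nt} li)) (⊔ʳ {N} (⊔ʳ {Ns ℕ.⊔ Nt} lj)))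

0ᴿ 1ᴿ : ℝ
0ᴿ = mkℝ (λ _ → 0ℚ) (const-cauchy 0ℚ)
1ᴿ = mkℝ (λ _ → 1ℚ) (const-cauchy 1ℚ)

_+ᴿ_ _*ᴿ_ : ℝ → ℝ → ℝ
x +ᴿ y = mkℝ (λ i → seq x i ℚ.+ seq y i)
             (+-cauchy {seq x} {seq y} (cauchy x) (cauchy y))
x *ᴿ y = mkℝ (λ i → seq x i ℚ.* seq y i)
             (*-cauchy {seq x} {seq y} (cauchy x) (cauchy y))

-ᴿ_ : ℝ → ℝ
-ᴿ x = mkℝ (λ i → ℚ.- seq x i) (neg-cauchy {seq x} (cauchy x))

pointwise⇒≈ᴿ : ∀ {x y} → (∀ i → seq x i ≡ seq y i) → x ≈ᴿ y
pointwise⇒≈ᴿ {x} {y} eq = mk≈ λ ε 0<ε → 0 , λ i _ →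
  subst (λ z → ∣ z ∣ < ε)
    (sym (trans (cong (ℚ._- seq y i) (eq i)) (ℚ.+-inverseʳ (seq y i)))) 0<ε

≈ᴿ-refl : ∀ {x} → x ≈ᴿ x
≈ᴿ-refl = pointwise⇒≈ᴿ λ _ → refl

≈ᴿ-sym : ∀ {x y} → x ≈ᴿ y → y ≈ᴿ x
≈ᴿ-sym {x} {y} (mk≈ p) = mk≈ λ ε 0<ε → let N , c = p ε 0<ε in
  N , λ i li → swap-small (seq x i) (seq y i) (c i li)

≈ᴿ-trans : ∀ {x y z} → x ≈ᴿ y → y ≈ᴿ z → x ≈ᴿ z
≈ᴿ-trans {x} {y} {z} (mk≈ p) (mk≈ q) = mk≈ λ ε 0<ε →
  let N , c = p (half ε) (half-pos 0<ε)
      M , d = q (half ε) (half-pos 0<ε)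
  in N ℕ.⊔ M , λ i li →
    subst (λ w → ∣ w ∣ < ε)
      (solve 3 (λ a b e → (a :- b) :+ (b :- e) := a :- e) refl
        (seq x i) (seq y i) (seq z i))
      (+-small _ _ (c i (⊔ˡ li)) (d i (⊔ʳ {N} li)))
  where open ℚ-Solve

+ᴿ-cong : ∀ {x x′ y y′} → x ≈ᴿ x′ → y ≈ᴿ y′ → x +ᴿ y ≈ᴿ x′ +ᴿ y′
+ᴿ-cong {x} {x′} {y} {y′} (mk≈ p) (mk≈ q) = mk≈ λ ε 0<ε →
  let N , c = p (half ε) (half-pos 0<ε)
      M , d = q (half ε) (half-pos 0<ε)
  in N ℕ.⊔ M , λ i li →
    subst (λ w → ∣ w ∣ < ε) (+-split (seq x i) (seq y i) (seq x′ i) (seq y′ i))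
      (+-small _ _ (c i (⊔ˡ li)) (d i (⊔ʳ {N} li)))

-ᴿ-cong : ∀ {x x′} → x ≈ᴿ x′ → -ᴿ x ≈ᴿ -ᴿ x′
-ᴿ-cong {x} {x′} (mk≈ p) = mk≈ λ ε 0<ε → let N , c = p ε 0<ε in
  N , λ i li → subst (λ w → ∣ w ∣ < ε) (neg-split (seq x i) (seq x′ i))
    (swap-small (seq x i) (seq x′ i) (c i li))

*ᴿ-cong : ∀ {x x′ y y′} → x ≈ᴿ x′ → y ≈ᴿ y′ → x *ᴿ y ≈ᴿ x′ *ᴿ y′
*ᴿ-cong {x} {x′} {y} {y′} (mk≈ p) (mk≈ q) = mk≈ λ ε 0<ε →
  let Bx , 0<Bx , Nx , x< = bounded {seq x} (cauchy x)
      By , 0<By , Ny , y< = bounded {seq y′} (cauchy y′)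
      N , c = p (over By 0<By (half ε)) (over-pos By 0<By (half-pos 0<ε))
      M , d = q (over Bx 0<Bx (half ε)) (over-pos Bx 0<Bx (half-pos 0<ε))
  in (Nx ℕ.⊔ Ny) ℕ.⊔ (N ℕ.⊔ M) , λ i li →
    *-close Bx 0<Bx By 0<By (seq x i) (seq y i) (seq x′ i) (seq y′ i)
      (x< i (⊔ˡ (⊔ˡ li))) (y< i (⊔ʳ {Nx} (⊔ˡ li)))
      (c i (⊔ˡ (⊔ʳ {Nx ℕ.⊔ Ny} li)))
      (d i (⊔ʳ {N} (⊔ʳ {Nx ℕ.⊔ Ny} li)))

ℝ-commutativeRing : CommutativeRing 0ℓ 0ℓ
ℝ-commutativeRing = record
  { Carrier = ℝ
  ; _≈_ = _≈ᴿ_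
  ; _+_ = _+ᴿ_
  ; _*_ = _*ᴿ_
  ; -_  = -ᴿ_
  ; 0#  = 0ᴿ
  ; 1#  = 1ᴿ
  ; isCommutativeRing = record
    { isRing = record
      { +-isAbelianGroup = record
        { isGroup = record
          { isMonoid = record
            { isSemigroup = record
              { isMagma = record
                { isEquivalence = record
                  { refl = ≈ᴿ-refl ; sym = ≈ᴿ-sym ; trans = ≈ᴿ-trans }
                ; ∙-cong = +ᴿ-cong
                }
              ; assoc = λ x y z → pointwise⇒≈ᴿ λ i →
                  ℚ.+-assoc (seq x i) (seq y i) (seq z i)
              }
            ; identity =
                (λ x → pointwise⇒≈ᴿ λ i → ℚ.+-identityˡ (seq x i))
              , (λ x → pointwise⇒≈ᴿ λ i → ℚ.+-identityʳ (seq x i))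
            }
          ; inverse =
              (λ x → pointwise⇒≈ᴿ λ i → ℚ.+-inverseˡ (seq x i))
            , (λ x → pointwise⇒≈ᴿ λ i → ℚ.+-inverseʳ (seq x i))
          ; ⁻¹-cong = -ᴿ-cong
          }
        ; comm = λ x y → pointwise⇒≈ᴿ λ i → ℚ.+-comm (seq x i) (seq y i)
        }
      ; *-cong = *ᴿ-cong
      ; *-assoc = λ x y z → pointwise⇒≈ᴿ λ i →
          ℚ.*-assoc (seq x i) (seq y i) (seq z i)
      ; *-identity =
          (λ x → pointwise⇒≈ᴿ λ i → ℚ.*-identityˡ (seq x i))
        , (λ x → pointwise⇒≈ᴿ λ i → ℚ.*-identityʳ (seq x i))
      ; distrib =
          (λ x y z → pointwise⇒≈ᴿ λ i →
            ℚ.*-distribˡ-+ (seq x i) (seq y i) (seq z i))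
        , (λ x y z → pointwise⇒≈ᴿ λ i →
            ℚ.*-distribʳ-+ (seq x i) (seq y i) (seq z i))
      }
    ; *-comm = λ x y → pointwise⇒≈ᴿ λ i → ℚ.*-comm (seq x i) (seq y i)
    }
  }

------------------------------------------------------------------------

-- R[i] with i² = D, that is, R[t]/(t² - D); below, ℂ is the case R = ℝ,
-- D = -1.  (A general D makes the ring laws semiring identities.)
module Adjoin√ {c ℓ : Level} (R : CommutativeRing c ℓ)
               (D : CommutativeRing.Carrier R) where

  open CommutativeRing R using
    ( Carrier; _≈_; _+_; _*_; -_; 0#; 1#; +-cong; *-cong; -‿cong
    ; *-identityˡ; zeroˡ; zeroʳ; commutativeSemiring
    ; +-assoc; +-comm; +-identityˡ; +-identityʳ; -‿inverseˡ; -‿inverseʳ)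
    renaming (refl to ≈-refl; sym to ≈-sym; trans to ≈-trans)

  infix 5 _+i_

  record Complex : Set c where
    constructor _+i_
    field
      re im : Carrier

  open Complex public

  infix 4 _≈ᶜ_ _,ᶜ_

  record _≈ᶜ_ (z w : Complex) : Set ℓ where
    constructor _,ᶜ_
    field
      re≈ : re z ≈ re w
      im≈ : im z ≈ im w

  open _≈ᶜ_ public

  infixl 7 _*ᶜ_

  _*ᶜ_ : Complex → Complex → Complex
  (a +i b) *ᶜ (c +i d) = (a * c + D * (b * d)) +i (a * d + b * c)

  private module Laws where
    open NaturalCoefficients commutativeSemiring
      using (solve; _:+_; _:*_; _:=_)

    assoc-re : ∀ a b c d e f →
      (a * c + D * (b * d)) * e + D * ((a * d + b * c) * f) ≈
      a * (c * e + D * (d * f)) + D * (b * (c * f + d * e))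
    assoc-re = solve 7 (λ D a b c d e f →
      (a :* c :+ D :* (b :* d)) :* e :+ D :* ((a :* d :+ b :* c) :* f) :=
      a :* (c :* e :+ D :* (d :* f)) :+ D :* (b :* (c :* f :+ d :* e))) ≈-refl D

    assoc-im : ∀ a b c d e f →
      (a * c + D * (b * d)) * f + (a * d + b * c) * e ≈
      a * (c * f + d * e) + b * (c * e + D * (d * f))
    assoc-im = solve 7 (λ D a b c d e f →
      (a :* c :+ D :* (b :* d)) :* f :+ (a :* d :+ b :* c) :* e :=
      a :* (c :* f :+ d :* e) :+ b :* (c :* e :+ D :* (d :* f))) ≈-refl D

    distˡ-re : ∀ a b c d e f →
      a * (c + e) + D * (b * (d + f)) ≈
      (a * c + D * (b * d)) + (a * e + D * (b * f))
    distˡ-re = solve 7 (λ D a b c d e f →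
      a :* (c :+ e) :+ D :* (b :* (d :+ f)) :=
      (a :* c :+ D :* (b :* d)) :+ (a :* e :+ D :* (b :* f))) ≈-refl D

    distˡ-im : ∀ a b c d e f →
      a * (d + f) + b * (c + e) ≈
      (a * d + b * c) + (a * f + b * e)
    distˡ-im = solve 6 (λ a b c d e f →
      a :* (d :+ f) :+ b :* (c :+ e) :=
      (a :* d :+ b :* c) :+ (a :* f :+ b :* e)) ≈-refl

    distʳ-re : ∀ a b c d e f →
      (c + e) * a + D * ((d + f) * b) ≈
      (c * a + D * (d * b)) + (e * a + D * (f * b))
    distʳ-re = solve 7 (λ D a b c d e f →
      (c :+ e) :* a :+ D :* ((d :+ f) :* b) :=
      (c :* a :+ D :* (d :* b)) :+ (e :* a :+ D :* (f :* b))) ≈-refl D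

    distʳ-im : ∀ a b c d e f →
      (c + e) * b + (d + f) * a ≈
      (c * b + d * a) + (e * b + f * a)
    distʳ-im = solve 6 (λ a b c d e f →
      (c :+ e) :* b :+ (d :+ f) :* a :=
      (c :* b :+ d :* a) :+ (e :* b :+ f :* a)) ≈-refl

    comm-re : ∀ a b c d →
      a * c + D * (b * d) ≈
      c * a + D * (d * b)
    comm-re = solve 5 (λ D a b c d →
      a :* c :+ D :* (b :* d) :=
      c :* a :+ D :* (d :* b)) ≈-refl D

    comm-im : ∀ a b c d →
      a * d + b * c ≈
      c * b + d * a
    comm-im = solve 4 (λ a b c d →
      a :* d :+ b :* c :=
      c :* b :+ d :* a) ≈-refl

  private
    open Laws

    +0* : ∀ x y → x + 0# * y ≈ x
    +0* x y = ≈-trans (+-cong ≈-refl (zeroˡ y)) (+-identityʳ x)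

    +D0* : ∀ x y → x + D * (0# * y) ≈ x
    +D0* x y = ≈-trans
      (+-cong ≈-refl (≈-trans (*-cong ≈-refl (zeroˡ y)) (zeroʳ D)))
      (+-identityʳ x)

    transᶜ : ∀ {x y z} → x ≈ᶜ y → y ≈ᶜ z → x ≈ᶜ z
    transᶜ (p ,ᶜ q) (p′ ,ᶜ q′) = ≈-trans p p′ ,ᶜ ≈-trans q q′

    *ᶜ-comm : ∀ x y → x *ᶜ y ≈ᶜ y *ᶜ x
    *ᶜ-comm (a +i b) (c +i d) = comm-re a b c d ,ᶜ comm-im a b c d

    identityˡ : ∀ z → (1# +i 0#) *ᶜ z ≈ᶜ z
    identityˡ (a +i b) =
      ≈-trans (+D0* (1# * a) b) (*-identityˡ a) ,ᶜ
      ≈-trans (+0* (1# * b) a) (*-identityˡ b)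

  commutativeRing : CommutativeRing c ℓ
  commutativeRing = record
    { Carrier = Complex
    ; _≈_ = _≈ᶜ_
    ; _+_ = λ (a +i b) (c +i d) → (a + c) +i (b + d)
    ; _*_ = _*ᶜ_
    ; -_  = λ (a +i b) → (- a) +i (- b)
    ; 0#  = 0# +i 0#
    ; 1#  = 1# +i 0#
    ; isCommutativeRing = record
      { isRing = record
        { +-isAbelianGroup = record
          { isGroup = record
            { isMonoid = record
              { isSemigroup = record
                { isMagma = record
                  { isEquivalence = record
                    { refl  = ≈-refl ,ᶜ ≈-refl
                    ; sym   = λ (p ,ᶜ q) → ≈-sym p ,ᶜ ≈-sym q
                    ; trans = transᶜ
                    }
                  ; ∙-cong = λ (p ,ᶜ q) (p′ ,ᶜ q′) →
                      +-cong p p′ ,ᶜ +-cong q q′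
                  }
                ; assoc = λ (a +i b) (c +i d) (e +i f) →
                    +-assoc a c e ,ᶜ +-assoc b d f
                }
              ; identity =
                  (λ (a +i b) → +-identityˡ a ,ᶜ +-identityˡ b)
                , (λ (a +i b) → +-identityʳ a ,ᶜ +-identityʳ b)
              }
            ; inverse =
                (λ (a +i b) → -‿inverseˡ a ,ᶜ -‿inverseˡ b)
              , (λ (a +i b) → -‿inverseʳ a ,ᶜ -‿inverseʳ b)
            ; ⁻¹-cong = λ (p ,ᶜ q) → -‿cong p ,ᶜ -‿cong q
            }
          ; comm = λ (a +i b) (c +i d) → +-comm a c ,ᶜ +-comm b d
          }
        ; *-cong = λ (p ,ᶜ q) (p′ ,ᶜ q′) →
            +-cong (*-cong p p′) (*-cong ≈-refl (*-cong q q′)) ,ᶜ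
            +-cong (*-cong p q′) (*-cong q p′)
        ; *-assoc = λ (a +i b) (c +i d) (e +i f) →
            assoc-re a b c d e f ,ᶜ assoc-im a b c d e f
        ; *-identity =
            identityˡ
          , λ z → transᶜ (*ᶜ-comm z (1# +i 0#)) (identityˡ z)
        ; distrib =
            (λ (a +i b) (c +i d) (e +i f) →
              distˡ-re a b c d e f ,ᶜ distˡ-im a b c d e f)
          , (λ (a +i b) (c +i d) (e +i f) →
              distʳ-re a b c d e f ,ᶜ distʳ-im a b c d e f)
        }
      ; *-comm = *ᶜ-comm
      }
    }

open Adjoin√ ℝ-commutativeRing (-ᴿ 1ᴿ) public
  renaming (Complex to ℂ; commutativeRing to ℂ-commutativeRing)

------------------------------------------------------------------------

module Matrices {c ℓ : Level} (S : RawSemiring c ℓ) where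

  open RawSemiring S
  open import Algebra.Definitions.RawMonoid +-rawMonoid using (sum)

  infix  4 _≈ᴹ_
  infixl 7 _⊗_

  Matrix : ℕ → Set c
  Matrix w = Fin w → Fin w → Carrier

  _≈ᴹ_ : ∀ {w} → Matrix w → Matrix w → Set ℓ
  A ≈ᴹ B = ∀ i j → A i j ≈ B i j

  identity : ∀ {w} → Matrix w
  identity i j = if does (i Fin.≟ j) then 1# else 0#

  _⊗_ : ∀ {w} → Matrix w → Matrix w → Matrix w
  (A ⊗ B) i j = sum λ k → A i k * B k j

  -- The ordered product A₀ ⊗ A₁ ⊗ ⋯ of a family of matrices.
  product : ∀ {w n} → (Fin n → Matrix w) → Matrix w
  product = Vector.foldr _⊗_ identity

  bilinear : ∀ {w} →
             (Fin w → Carrier) → Matrix w → (Fin w → Carrier) → Carrier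
  bilinear u A v = sum λ i → sum λ j → u i * A i j * v j

------------------------------------------------------------------------

-- A partition of the variables into d parts is given by the sizes
-- m : Fin d → ℕ of the parts; the variable x_{j,k} is (j , k).
Var : ∀ {d} → (Fin d → ℕ) → Set
Var {d} m = Σ (Fin d) λ j → Fin (m j)

-- The exponent e of the monomial 𝐱ᵉ.
Exponent : ∀ {d} → (Fin d → ℕ) → Set
Exponent m = Var m → ℕ

module _ {d : ℕ} {m : Fin d → ℕ} where

  _≟ⱽ_ : DecidableEquality (Var m)
  _≟ⱽ_ = Product.≡-dec Fin._≟_ Fin._≟_

  _≟ᴱ_ : (a b : Exponent m) → Dec (∀ x → a x ≡ b x)
  a ≟ᴱ b = map′ (λ eq (j , k) → eq j k) (λ eq j k → eq (j , k))
    (Fin.all? λ j → Fin.all? λ k → a (j , k) ℕ.≟ b (j , k))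

  δ : Var m → Exponent m
  δ x y = if does (x ≟ⱽ y) then 1 else 0

  vars : List (Var m)
  vars = List.concatMap (λ j → List.map (j ,_) (allFin (m j))) (allFin d)

  IsSetMultilinearMonomial : Exponent m → Set
  IsSetMultilinearMonomial e = ∀ j →
    ∃[ k ] e (j , k) ≡ 1 × (∀ k′ → k′ ≢ k → e (j , k′) ≡ 0)

------------------------------------------------------------------------

module Polynomials {c ℓ : Level} (R : CommutativeRing c ℓ) where

  open CommutativeRing R
  open import Algebra.Definitions.RawMonoid +-rawMonoid
    using () renaming (_×_ to _·_)

  -- A formal sum of terms a 𝐱ᵉ, in which exponents may be repeated and
  -- coefficients may vanish; polynomials are such sums up to _≈ᴾ_.
  Poly : ∀ {d} → (Fin d → ℕ) → Set c
  Poly m = List (Carrier × Exponent m)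

  module _ {d : ℕ} {m : Fin d → ℕ} where

    infix 4 _≈ᴾ_

    coeff : Poly m → Exponent m → Carrier
    coeff []            e = 0#
    coeff ((a , e′) ∷ p) e =
      if does (e′ ≟ᴱ e) then a + coeff p e else coeff p e

    _≈ᴾ_ : Poly m → Poly m → Set ℓ
    p ≈ᴾ q = ∀ e → coeff p e ≈ coeff q e

    const : Carrier → Poly m
    const a = (a , λ _ → 0) ∷ []

    var : Var m → Poly m
    var x = (1# , δ x) ∷ []

    _+ᴾ_ _*ᴾ_ : Poly m → Poly m → Poly m
    _+ᴾ_ = _++_
    _*ᴾ_ = List.cartesianProductWith
      λ (a , e) (b , e′) → a * b , λ x → e x ℕ.+ e′ x

    ∂ : Var m → Poly m → Poly m
    ∂ x = List.map λ (a , e) → e x · a , λ y → e y ℕ.∸ δ x y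

    ∂^ : ℕ → Var m → Poly m → Poly m
    ∂^ zero    x p = p
    ∂^ (suc k) x p = ∂ x (∂^ k x p)

    -- Partial derivatives commute up to _≈ᴾ_, so the order of the
    -- variables in vars is immaterial.
    ∂ᴱ : Exponent m → Poly m → Poly m
    ∂ᴱ e p = List.foldr (λ x → ∂^ (e x) x) p vars

    IsSetMultilinear : Poly m → Set ℓ
    IsSetMultilinear f =
      ∀ e → ¬ (coeff f e ≈ 0#) → IsSetMultilinearMonomial e

  polyRawSemiring : ∀ {d} → (Fin d → ℕ) → RawSemiring c ℓ
  polyRawSemiring m = record
    { Carrier = Poly m
    ; _≈_ = _≈ᴾ_
    ; _+_ = _+ᴾ_
    ; _*_ = _*ᴾ_
    ; 0#  = []
    ; 1#  = const 1#
    }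

  module _ {d : ℕ} {m : Fin d → ℕ} where

    open import Algebra.Definitions.RawMonoid
      (RawSemiring.+-rawMonoid (polyRawSemiring m)) using (sum)

    combination : ∀ {n} → (Fin n → Carrier) → (Fin n → Poly m) → Poly m
    combination a b = sum λ i → const (a i) *ᴾ b i

    Span : ∀ {i} {I : Set i} → (I → Poly m) → Poly m → Set (c ⊔ ℓ ⊔ i)
    Span {I = I} g p = ∃[ n ] Σ (Fin n → Carrier) λ a → Σ (Fin n → I) λ s →
      p ≈ᴾ combination a (g ∘ s)

    LinearlyIndependent : ∀ {n} → (Fin n → Poly m) → Set (c ⊔ ℓ)
    LinearlyIndependent b =
      ∀ a → combination a b ≈ᴾ [] → ∀ i → a i ≈ 0#

    record IsBasis {i} {n} (b : Fin n → Poly m) (V : Poly m → Set i)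
           : Set (c ⊔ ℓ ⊔ i) where
      field
        members     : ∀ i → V (b i)
        spanning    : ∀ p → V p → ∃[ a ] p ≈ᴾ combination a b
        independent : LinearlyIndependent b

    HasDimension : ∀ {i} → (Poly m → Set i) → ℕ → Set (c ⊔ ℓ ⊔ i)
    HasDimension V n = Σ (Fin n → Poly m) λ b → IsBasis b V

    -- DPD(f) = n.  This is a relation since a basis cannot be computed
    -- without deciding equality of scalars.
    DPD : Poly m → ℕ → Set (c ⊔ ℓ)
    DPD f = HasDimension (Span λ e → ∂ᴱ e f)

  private
    module MatR = Matrices (Semiring.rawSemiring semiring)
    module MatP {d} (m : Fin d → ℕ) = Matrices (polyRawSemiring m)

  record SmABP {d} (m : Fin d → ℕ) (w : ℕ) : Set c where
    field
      σ   : Permutation′ d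
      A   : Var m → MatR.Matrix w
      u v : Fin w → Carrier

    open import Algebra.Definitions.RawMonoid
      (RawSemiring.+-rawMonoid (polyRawSemiring m)) using (sum)

    M : Fin d → MatP.Matrix m w
    M j r s = sum λ k → const (A (j , k) r s) *ᴾ var (j , k)

    polynomial : Poly m
    polynomial = MatP.bilinear m (const ∘ u)
      (MatP.product m λ i → M (σ ⟨$⟩ʳ i)) (const ∘ v)

    Commutative : Set ℓ
    Commutative = ∀ x y → (A x MatR.⊗ A y) MatR.≈ᴹ (A y MatR.⊗ A x)

  module _ {d : ℕ} {m : Fin d → ℕ} where

    HasCommutativeSmABP : Poly m → ℕ → Set (c ⊔ ℓ)
    HasCommutativeSmABP f w = Σ (SmABP m w) λ P →
      SmABP.Commutative P × f ≈ᴾ SmABP.polynomial P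

    IsSmallestCommutativeWidth : Poly m → ℕ → Set (c ⊔ ℓ)
    IsSmallestCommutativeWidth f w =
      HasCommutativeSmABP f w ×
      (∀ w′ → HasCommutativeSmABP f w′ → w ℕ.≤ w′)

    -- Constructively, a nonempty set of naturals need not have a least
    -- element, so the bound is asserted both of the least width and, as
    -- a witness, of some width.
    SmallestCommutativeWidth≤ : Poly m → ℕ → Set (c ⊔ ℓ)
    SmallestCommutativeWidth≤ f n =
      (∃[ w ] w ℕ.≤ n × HasCommutativeSmABP f w) ×
      (∀ w → IsSmallestCommutativeWidth f w → w ℕ.≤ n)

open Polynomials ℂ-commutativeRing public

{-# OPTIONS --safe #-}
module Submission where

-- Let b₁, …, bₙ be a basis of the span of the partial derivatives of f.
-- This span is closed under every ∂_x, so ∂_x bᵢ = Σₗ A_x(i,l) bₗ, and the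
-- matrices A_x commute because partial derivatives do and b is independent.
-- Write f = Σᵢ uᵢ bᵢ and vⱼ = bⱼ(0).  If g = Σᵢ aᵢ bᵢ is homogeneous of degree
-- one in each of the parts t₀, t₁, … and involves no other part, then Euler's
-- identity g = Σₖ x_{t₀,k} ∂_{t₀,k} g, in which ∂_{t₀,k} g has coordinates
-- a A_{t₀,k} and involves only t₁, …, gives g = aᵀ M_{t₀} M_{t₁} ⋯ v by
-- induction.  Take g = f and a = u.

open import Algebra.Bundles using (CommutativeRing; RawSemiring; Semiring)
import Algebra.Properties.CommutativeMonoid.Sum
open import Data.Bool.Base using (true; false; if_then_else_)
open import Data.Fin.Base using (Fin; zero; suc)
import Data.Fin.Properties as Fin
import Data.Fin.Permutation as Perm
open import Data.List.Base as List using (List; []; _∷_; _++_; allFin)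
import Data.List.Properties as List
open import Data.List.Membership.Propositional using (_∈_)
open import Data.List.Membership.Propositional.Properties
  using (∈-allFin; ∈-map⁺; ∈-map⁻; ∈-concat⁺′)
open import Data.List.Relation.Unary.All as All using (All; []; _∷_)
import Data.List.Relation.Unary.All.Properties as All
open import Data.List.Relation.Unary.AllPairs using ([]; _∷_)
import Data.List.Relation.Unary.AllPairs as AllPairs
import Data.List.Relation.Unary.AllPairs.Properties as AllPairs
open import Data.List.Relation.Unary.Any using (here; there)
open import Data.List.Relation.Unary.Unique.Propositional using (Unique)
import Data.List.Relation.Unary.Unique.Propositional.Properties as Unique
open import Data.Nat.Base as ℕ using (ℕ; zero; suc)
import Data.Nat.Properties as ℕ
open import Data.Product.Base using (∃-syntax; _×_; _,_; proj₁; proj₂)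
open import Data.Rational.Base as ℚ using (ℚ; 0ℚ; ½; ∣_∣)
import Data.Rational.Properties as ℚ
import Data.Rational.Solver as ℚ
open import Data.Sum.Base using (_⊎_; inj₁; inj₂)
open import Function.Base using (_∘_; id)
open import Function.Bundles using (mk⇔)
open import Function.Definitions using (Injective)
open import Relation.Binary.PropositionalEquality.Core as ≡
  using (_≡_; _≢_; _≗_; cong; cong₂; subst)
open import Relation.Nullary.Decidable using (yes; no; does; dec-true; dec-false; does-⇔)
open import Relation.Nullary.Negation.Core using (¬_; contradiction)

open import Defs
  using ( Var; Exponent; _≟ⱽ_; _≟ᴱ_; δ; vars; IsSetMultilinearMonomial
        ; module Matrices; module Polynomials)

-- Exponents and their degrees in the parts.

module Sumᴺ = Algebra.Properties.CommutativeMonoid.Sum ℕ.+-0-commutativeMonoid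
open Sumᴺ using () renaming (sum to sumᴺ)

sumᴺ-single : ∀ {n} (f : Fin n → ℕ) k → (∀ k′ → k′ ≢ k → f k′ ≡ 0) → sumᴺ f ≡ f k
sumᴺ-single {suc n} f zero    off = ≡.trans
  (cong (f zero ℕ.+_) (≡.trans (Sumᴺ.sum-cong-≗ λ k → off (suc k) λ ()) (Sumᴺ.sum-replicate-zero n)))
  (ℕ.+-identityʳ (f zero))
sumᴺ-single {suc n} f (suc k) off = ≡.trans
  (cong (ℕ._+ sumᴺ (f ∘ suc)) (off zero λ ()))
  (sumᴺ-single (f ∘ suc) k λ k′ k′≢k → off (suc k′) (k′≢k ∘ Fin.suc-injective))

sumᴺ≡0⇒≡0 : ∀ {n} (f : Fin n → ℕ) → sumᴺ f ≡ 0 → ∀ k → f k ≡ 0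
sumᴺ≡0⇒≡0 f eq zero    = ℕ.m+n≡0⇒m≡0 (f zero) eq
sumᴺ≡0⇒≡0 f eq (suc k) = sumᴺ≡0⇒≡0 (f ∘ suc) (ℕ.m+n≡0⇒n≡0 (f zero) eq) k

module _ {d : ℕ} {m : Fin d → ℕ} where

  infixl 6 _+δ_ _∸δ_

  _+δ_ _∸δ_ : Exponent m → Var m → Exponent m
  (e +δ x) y = e y ℕ.+ δ x y
  (e ∸δ x) y = e y ℕ.∸ δ x y

  δ-diag : ∀ (x : Var m) → δ x x ≡ 1
  δ-diag x = cong (if_then 1 else 0) (dec-true (x ≟ⱽ x) ≡.refl)

  δ-off : ∀ (x y : Var m) → x ≢ y → δ x y ≡ 0
  δ-off x y x≢y = cong (if_then 1 else 0) (dec-false (x ≟ⱽ y) x≢y)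

  +δ-at : ∀ e (x : Var m) → (e +δ x) x ≡ suc (e x)
  +δ-at e x = ≡.trans (cong (e x ℕ.+_) (δ-diag x)) (ℕ.+-comm (e x) 1)

  +δ-off : ∀ e (x y : Var m) → x ≢ y → (e +δ x) y ≡ e y
  +δ-off e x y x≢y = ≡.trans (cong (e y ℕ.+_) (δ-off x y x≢y)) (ℕ.+-identityʳ (e y))

  +δ-∸δ : ∀ e (x : Var m) → e +δ x ∸δ x ≗ e
  +δ-∸δ e x y = ℕ.m+n∸n≡m (e y) (δ x y)

  ∸δ-+δ : ∀ e (x : Var m) {k} → e x ≡ suc k → e ∸δ x +δ x ≗ e
  ∸δ-+δ e x ex≡1+k y = ℕ.m∸n+n≡m δxy≤ey
    where
    δxy≤ey : δ x y ℕ.≤ e y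
    δxy≤ey with x ≟ⱽ y
    ... | yes ≡.refl = subst (1 ℕ.≤_) (≡.sym ex≡1+k) (ℕ.s≤s ℕ.z≤n)
    ... | no  _      = ℕ.z≤n

  deg : Fin d → Exponent m → ℕ
  deg j e = sumᴺ λ k → e (j , k)

  deg-+δ-same : ∀ e j (k : Fin (m j)) → deg j (e +δ (j , k)) ≡ suc (deg j e)
  deg-+δ-same e j k = ≡.trans (Sumᴺ.∑-distrib-+ (λ k′ → e (j , k′)) (λ k′ → δ {m = m} (j , k) (j , k′)))
    (≡.trans (cong (deg j e ℕ.+_) deg-δ) (ℕ.+-comm (deg j e) 1))
    where
    deg-δ : deg j (δ (j , k)) ≡ 1
    deg-δ = ≡.trans
      (sumᴺ-single (λ k′ → δ {m = m} (j , k) (j , k′)) k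
        λ k′ k′≢k → δ-off (j , k) (j , k′) λ { ≡.refl → k′≢k ≡.refl })
      (δ-diag (j , k))

  deg-+δ-other : ∀ e {j} (x : Var m) → proj₁ x ≢ j → deg j (e +δ x) ≡ deg j e
  deg-+δ-other e {j} x x≢j = Sumᴺ.sum-cong-≗ {m j} λ k → +δ-off e x (j , k) λ x≡ → x≢j (cong proj₁ x≡)

  deg≡1 : ∀ {e : Exponent m} → IsSetMultilinearMonomial e → ∀ j → deg j e ≡ 1
  deg≡1 {e} sm j with sm j
  ... | k , ek≡1 , off = ≡.trans (sumᴺ-single (λ k′ → e (j , k′)) k off) ek≡1

  -- Degrees are all that Euler's identity needs. They are also decidable, so exponents can be split
  -- into cases without inspecting a coefficient.
  HasParts : ∀ {n} → (Fin n → Fin d) → Exponent m → Set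
  HasParts t e = (∀ i → deg (t i) e ≡ 1) × (∀ j → (∀ i → t i ≢ j) → deg j e ≡ 0)

  HasParts-[] : ∀ {t : Fin 0 → Fin d} {e} → HasParts t e → (λ _ → 0) ≗ e
  HasParts-[] {e = e} (_ , none) (j , k) = ≡.sym (sumᴺ≡0⇒≡0 (λ k → e (j , k)) (none j λ ()) k)

  -- Removing the variable of part `t zero` lowers its degree from one to zero. Injectivity of `t`
  -- keeps `t zero` from recurring in the tail, so the other degrees are unchanged.
  HasParts-tail : ∀ {n} {t : Fin (suc n) → Fin d} → Injective _≡_ _≡_ t →
    ∀ e k → HasParts t (e +δ (t zero , k)) → HasParts (t ∘ suc) e
  HasParts-tail {t = t} t-inj e k (once , none) = once′ , none′
    where
    once′ : ∀ i → deg (t (suc i)) e ≡ 1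
    once′ i = ≡.trans
      (≡.sym (deg-+δ-other e (t zero , k) λ eq → Fin.0≢1+n (t-inj eq)))
      (once (suc i))
    none′ : ∀ j → (∀ i → t (suc i) ≢ j) → deg j e ≡ 0
    none′ j ∉tail with t zero Fin.≟ j
    ... | yes ≡.refl = ℕ.suc-injective (≡.trans (≡.sym (deg-+δ-same e (t zero) k)) (once zero))
    ... | no  t0≢j   = ≡.trans (≡.sym (deg-+δ-other e (t zero , k) t0≢j))
      (none j λ { zero → t0≢j ; (suc i) → ∉tail i })

  private
    part : (j : Fin d) → List (Var m)
    part j = List.map (j ,_) (allFin (m j))

  ∈-vars : ∀ (x : Var m) → x ∈ vars
  ∈-vars (j , k) =
    ∈-concat⁺′ {xss = List.map part (allFin d)} (∈-map⁺ (j ,_) (∈-allFin k)) (∈-map⁺ part (∈-allFin j))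

  -- Needed for `∂ᴱ`: in its fold over `vars`, a repeated variable would be differentiated by too
  -- often.
  vars-unique : Unique (vars {m = m})
  vars-unique = Unique.concat⁺
    (All.map⁺ (All.tabulate λ {j} _ → Unique.map⁺ (λ { ≡.refl → ≡.refl }) (Unique.allFin⁺ (m j))))
    (AllPairs.map⁺ (AllPairs.map disjoint (Unique.allFin⁺ d)))
    where
    disjoint : ∀ {i j} → i ≢ j → ∀ {x} → ¬ (x ∈ part i × x ∈ part j)
    disjoint i≢j (x∈i , x∈j) with ∈-map⁻ _ x∈i | ∈-map⁻ _ x∈j
    ... | _ , _ , ≡.refl | _ , _ , ≡.refl = i≢j ≡.refl

module _ {c ℓ} (R : CommutativeRing c ℓ) where

  open CommutativeRing R hiding (zero)
  open import Algebra.Properties.Semiring.Sum semiring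
    using (sum; sum-cong-≋; sum-replicate-zero; ∑-distrib-+; ∑-comm; *-distribˡ-sum; *-distribʳ-sum)
  open import Algebra.Properties.CommutativeMonoid.Mult +-commutativeMonoid
    using (×-congʳ; ×-congˡ; ×-assocˡ; ×-distrib-+; ×-homo-+; ×-homo-1) renaming (_×_ to _·_)
  open import Algebra.Properties.Semiring.Mult semiring using (×-comm-*)
  open import Relation.Binary.Reasoning.Setoid setoid
  open Polynomials R

  private module MatR = Matrices (Semiring.rawSemiring semiring)

  -- Finite sums of scalars.

  sum-zero : ∀ {n} {f : Fin n → Carrier} → (∀ i → f i ≈ 0#) → sum f ≈ 0#
  sum-zero {n} f≈0 = trans (sum-cong-≋ f≈0) (sum-replicate-zero n)

  ·-zero : ∀ k → k · 0# ≈ 0#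
  ·-zero zero    = refl
  ·-zero (suc k) = trans (+-identityˡ _) (·-zero k)

  ·-sum : ∀ k {n} (f : Fin n → Carrier) → k · sum f ≈ sum (λ i → k · f i)
  ·-sum k {zero}  f = ·-zero k
  ·-sum k {suc n} f = trans (×-distrib-+ _ _ k) (+-congˡ (·-sum k (f ∘ suc)))

  -- Used when the first factor is peeled off a path sum: the variable of the first part must come
  -- outermost and the start index innermost.
  sum-reverse : ∀ {p q r s} (f : Fin p → Fin q → Fin r → Fin s → Carrier) →
    sum (λ i → sum λ j → sum λ k → sum λ l → f i j k l) ≈
    sum (λ l → sum λ k → sum λ j → sum λ i → f i j k l)
  sum-reverse {p} {q} {r} {s} f = begin
    sum (λ i → sum λ j → sum λ k → sum λ l → f i j k l)
      ≈⟨ sum-cong-≋ {p} (λ i → trans (sum-cong-≋ {q} λ j → ∑-comm (f i j))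
           (∑-comm λ j l → sum λ k → f i j k l)) ⟩
    sum (λ i → sum λ l → sum λ j → sum λ k → f i j k l)
      ≈⟨ ∑-comm (λ i l → sum λ j → sum λ k → f i j k l) ⟩
    sum (λ l → sum λ i → sum λ j → sum λ k → f i j k l)
      ≈⟨ sum-cong-≋ {s} (λ l → trans (sum-cong-≋ {p} λ i → ∑-comm (λ j k → f i j k l))
           (∑-comm λ i k → sum λ j → f i j k l)) ⟩
    sum (λ l → sum λ k → sum λ i → sum λ j → f i j k l)
      ≈⟨ sum-cong-≋ {s} (λ l → sum-cong-≋ {r} λ k → ∑-comm (λ i j → f i j k l)) ⟩
    sum (λ l → sum λ k → sum λ j → sum λ i → f i j k l) ∎

  sum-diagonal : ∀ {n} (f : Fin n → Fin n → Carrier) →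
    sum (λ i → sum λ j → if does (i Fin.≟ j) then f i j else 0#) ≈ sum (λ i → f i i)
  sum-diagonal {zero}  f = refl
  sum-diagonal {suc n} f = begin
    (f zero zero + sum {n} (λ _ → 0#)) +
    sum (λ i → 0# + sum λ j → if does (i Fin.≟ j) then f (suc i) (suc j) else 0#)
      ≈⟨ +-cong (trans (+-congˡ (sum-replicate-zero n)) (+-identityʳ _))
           (sum-cong-≋ {n} λ _ → +-identityˡ _) ⟩
    f zero zero + sum (λ i → sum λ j → if does (i Fin.≟ j) then f (suc i) (suc j) else 0#)
      ≈⟨ +-congˡ (sum-diagonal λ i j → f (suc i) (suc j)) ⟩
    sum (λ i → f i i) ∎

  module _ {d : ℕ} {m : Fin d → ℕ} where

    private
      open import Algebra.Definitions.RawMonoid (RawSemiring.+-rawMonoid (polyRawSemiring m))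
        using () renaming (sum to sumᴾ)
      module MatP = Matrices (polyRawSemiring m)

    -- Coefficients of sums and products.

    -- Exponents are functions known to agree only pointwise, but `coeff` consults them solely
    -- through `_≟ᴱ_`, whose Boolean respects pointwise equality.
    coeff-ext : ∀ (p : Poly m) {e e′} → e ≗ e′ → coeff p e ≡ coeff p e′
    coeff-ext []             e≗e′ = ≡.refl
    coeff-ext ((a , e₀) ∷ p) {e} {e′} e≗e′ = cong₂ (λ b y → if b then a + y else y)
      (does-⇔ (mk⇔ (λ eq x → ≡.trans (eq x) (e≗e′ x)) (λ eq x → ≡.trans (eq x) (≡.sym (e≗e′ x))))
        (e₀ ≟ᴱ e) (e₀ ≟ᴱ e′))
      (coeff-ext p e≗e′)

    coeff-∷-yes : ∀ {a e₀ e} (p : Poly m) → e₀ ≗ e → coeff ((a , e₀) ∷ p) e ≈ a + coeff p e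
    coeff-∷-yes {e₀ = e₀} {e} p e₀≗e rewrite dec-true (e₀ ≟ᴱ e) e₀≗e = refl

    coeff-∷-no : ∀ {a e₀ e} (p : Poly m) → ¬ (e₀ ≗ e) → coeff ((a , e₀) ∷ p) e ≈ coeff p e
    coeff-∷-no {e₀ = e₀} {e} p e₀≇e rewrite dec-false (e₀ ≟ᴱ e) e₀≇e = refl

    coeff-++ : ∀ (p q : Poly m) e → coeff (p ++ q) e ≈ coeff p e + coeff q e
    coeff-++ []             q e = sym (+-identityˡ _)
    coeff-++ ((a , e₀) ∷ p) q e with does (e₀ ≟ᴱ e)
    ... | true  = trans (+-congˡ (coeff-++ p q e)) (sym (+-assoc _ _ _))
    ... | false = coeff-++ p q e

    coeff-sum : ∀ {n} (p : Fin n → Poly m) e → coeff (sumᴾ p) e ≈ sum (λ i → coeff (p i) e)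
    coeff-sum {zero}  p e = refl
    coeff-sum {suc n} p e = trans (coeff-++ (p zero) _ e) (+-congˡ (coeff-sum (p ∘ suc) e))

    coeff-sum-* : ∀ {n} (p : Fin n → Poly m) q e → coeff (sumᴾ p *ᴾ q) e ≈ sum (λ i → coeff (p i *ᴾ q) e)
    coeff-sum-* {zero}  p q e = refl
    coeff-sum-* {suc n} p q e = trans
      (reflexive (cong (λ r → coeff r e) (List.cartesianProductWith-distribʳ-++ _ (p zero) _ q)))
      (trans (coeff-++ (p zero *ᴾ q) _ e) (+-congˡ (coeff-sum-* (p ∘ suc) q e)))

    -- Adding `e₀` is injective on exponents, so exactly the terms of `q` at `e` land on the shifted
    -- exponent.
    coeff-monomial-* : ∀ a e₀ (q : Poly m) e →
      coeff (((a , e₀) ∷ []) *ᴾ q) (λ x → e₀ x ℕ.+ e x) ≈ a * coeff q e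
    coeff-monomial-* a e₀ []            e = sym (zeroʳ a)
    coeff-monomial-* a e₀ ((b , e₁) ∷ q) e
      rewrite does-⇔ (mk⇔ (λ eq x → ℕ.+-cancelˡ-≡ (e₀ x) _ _ (eq x)) (λ eq x → cong (e₀ x ℕ.+_) (eq x)))
                (_≟ᴱ_ {m = m} (λ x → e₀ x ℕ.+ e₁ x) (λ x → e₀ x ℕ.+ e x)) (e₁ ≟ᴱ e)
      with does (e₁ ≟ᴱ e)
    ... | true  = trans (+-congˡ (coeff-monomial-* a e₀ q e)) (sym (distribˡ a b _))
    ... | false = coeff-monomial-* a e₀ q e

    coeff-monomial-*-zero : ∀ a {e₀} (q : Poly m) {e} →
      (∀ (e₁ : Exponent m) → ¬ ((λ x → e₀ x ℕ.+ e₁ x) ≗ e)) →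
      coeff (((a , e₀) ∷ []) *ᴾ q) e ≈ 0#
    coeff-monomial-*-zero a      []             e₀∤e = refl
    coeff-monomial-*-zero a {e₀} ((b , e₁) ∷ q) {e} e₀∤e
      rewrite dec-false ((λ x → e₀ x ℕ.+ e₁ x) ≟ᴱ e) (e₀∤e e₁) = coeff-monomial-*-zero a q e₀∤e

    coeff-const-* : ∀ a (q : Poly m) e → coeff (const a *ᴾ q) e ≈ a * coeff q e
    coeff-const-* a q e = coeff-monomial-* a (λ _ → 0) q e

    coeff-*-const : ∀ (p : Poly m) a e → coeff (p *ᴾ const a) e ≈ coeff p e * a
    coeff-*-const []             a e = sym (zeroˡ a)
    coeff-*-const ((b , e₀) ∷ p) a e
      rewrite does-⇔ (mk⇔ (λ eq x → ≡.trans (≡.sym (ℕ.+-identityʳ (e₀ x))) (eq x))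
                          (λ eq x → ≡.trans (ℕ.+-identityʳ (e₀ x)) (eq x)))
                (_≟ᴱ_ {m = m} (λ x → e₀ x ℕ.+ 0) e) (e₀ ≟ᴱ e)
      with does (e₀ ≟ᴱ e)
    ... | true  = trans (+-congˡ (coeff-*-const p a e)) (sym (distribʳ a b _))
    ... | false = coeff-*-const p a e

    coeff-combination : ∀ {n} (a : Fin n → Carrier) (b : Fin n → Poly m) e →
      coeff (combination a b) e ≈ sum (λ i → a i * coeff (b i) e)
    coeff-combination a b e = trans (coeff-sum (λ i → const (a i) *ᴾ b i) e)
      (sum-cong-≋ λ i → coeff-const-* (a i) (b i) e)

    -- when (e x) (coeff q (e ∸δ x)) is the coefficient of 𝐱ᵉ in x q: the guard
    -- rules out the truncated subtraction in e ∸δ x.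
    when : ℕ → Carrier → Carrier
    when zero    a = 0#
    when (suc _) a = a

    when-cong : ∀ k {a a′} → a ≈ a′ → when k a ≈ when k a′
    when-cong zero    _    = refl
    when-cong (suc _) a≈a′ = a≈a′

    when-*ˡ : ∀ k a y → a * when k y ≈ when k (a * y)
    when-*ˡ zero    a y = zeroʳ a
    when-*ˡ (suc _) a y = refl

    when-*ʳ : ∀ k y a → when k y * a ≈ when k (y * a)
    when-*ʳ zero    y a = zeroˡ a
    when-*ʳ (suc _) y a = refl

    when-sum : ∀ k {n} (f : Fin n → Carrier) → sum (λ i → when k (f i)) ≈ when k (sum f)
    when-sum zero    {n} f = sum-replicate-zero n
    when-sum (suc _) f = refl

    coeff-var-* : ∀ a x (q : Poly m) e →
      coeff ((const a *ᴾ var x) *ᴾ q) e ≈ a * when (e x) (coeff q (e ∸δ x))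
    coeff-var-* a x q e with e x in eq
    -- No exponent `δ x + e₁` equals `e` here: it is positive at `x`, while `e x` is 0.
    ... | zero  = trans (coeff-monomial-*-zero (a * 1#) q λ e₁ e≗ →
                    ℕ.1+n≢0 (≡.trans (≡.trans (cong (ℕ._+ e₁ x) {x = 1} (≡.sym (δ-diag x))) (e≗ x)) eq))
                  (sym (zeroʳ a))
    ... | suc _ = begin
      coeff ((const a *ᴾ var x) *ᴾ q) e
        ≡⟨ coeff-ext ((const a *ᴾ var x) *ᴾ q) (λ y →
             ≡.trans (≡.sym (∸δ-+δ e x eq y)) (ℕ.+-comm _ (δ x y))) ⟩
      coeff ((const a *ᴾ var x) *ᴾ q) (λ y → δ x y ℕ.+ (e ∸δ x) y)
        ≈⟨ coeff-monomial-* (a * 1#) (δ x) q (e ∸δ x) ⟩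
      a * 1# * coeff q (e ∸δ x)
        ≈⟨ *-congʳ (*-identityʳ a) ⟩
      a * coeff q (e ∸δ x) ∎

    -- Partial derivatives.

    -- A term can contribute to 𝐱ᵉ only if its exponent is `e +δ x`, and differentiation then brings
    -- down the factor `suc (e x)`.
    coeff-∂ : ∀ x (p : Poly m) e → coeff (∂ x p) e ≈ suc (e x) · coeff p (e +δ x)
    coeff-∂ x []             e = sym (·-zero (suc (e x)))
    coeff-∂ x ((a , e₀) ∷ p) e with e₀ ≟ᴱ (e +δ x)
    ... | yes e₀≗ = begin
      coeff (∂ x ((a , e₀) ∷ p)) e
        ≈⟨ coeff-∷-yes (∂ x p) (λ y → ≡.trans (cong (ℕ._∸ δ x y) (e₀≗ y)) (+δ-∸δ e x y)) ⟩
      e₀ x · a + coeff (∂ x p) e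
        ≈⟨ +-cong (×-congˡ (≡.trans (e₀≗ x) (+δ-at e x))) (coeff-∂ x p e) ⟩
      suc (e x) · a + suc (e x) · coeff p (e +δ x)
        ≈⟨ ×-distrib-+ _ _ (suc (e x)) ⟨
      suc (e x) · (a + coeff p (e +δ x))
        ≈⟨ ×-congʳ (suc (e x)) (coeff-∷-yes p e₀≗) ⟨
      suc (e x) · coeff ((a , e₀) ∷ p) (e +δ x) ∎
    ... | no e₀≇ = begin
      coeff (∂ x ((a , e₀) ∷ p)) e
        ≈⟨ vanishes ⟩
      coeff (∂ x p) e
        ≈⟨ coeff-∂ x p e ⟩
      suc (e x) · coeff p (e +δ x)
        ≈⟨ ×-congʳ (suc (e x)) (coeff-∷-no p e₀≇) ⟨
      suc (e x) · coeff ((a , e₀) ∷ p) (e +δ x) ∎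
      where
      vanishes : coeff (∂ x ((a , e₀) ∷ p)) e ≈ coeff (∂ x p) e
      vanishes with (e₀ ∸δ x) ≟ᴱ e
      ... | no  ≇e = coeff-∷-no (∂ x p) ≇e
      ... | yes ≗e with e₀ x in eq
      -- Here `e₀ ∸δ x` equals `e` only because subtraction is truncated at 0; the term is harmless,
      -- its coefficient being `0 · a`.
      ...   | zero  = trans (coeff-∷-yes (∂ x p) ≗e) (+-identityˡ _)
      ...   | suc _ = contradiction (λ y → ≡.trans (≡.sym (∸δ-+δ e₀ x eq y)) (cong (ℕ._+ δ x y) (≗e y))) e₀≇

    ∂-cong : ∀ x (p q : Poly m) → p ≈ᴾ q → ∂ x p ≈ᴾ ∂ x q
    ∂-cong x p q p≈q e =
      trans (coeff-∂ x p e) (trans (×-congʳ (suc (e x)) (p≈q _)) (sym (coeff-∂ x q e)))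

    -- For distinct variables both sides scale the coefficient at `e +δ x +δ y` by the product of
    -- `suc (e x)` and `suc (e y)`, since adding one variable leaves the exponent of the other
    -- alone.
    ∂-comm : ∀ x y (p : Poly m) → ∂ x (∂ y p) ≈ᴾ ∂ y (∂ x p)
    ∂-comm x y p e with x ≟ⱽ y
    ... | yes ≡.refl = refl
    ... | no  x≢y    = begin
      coeff (∂ x (∂ y p)) e
        ≈⟨ twice x≢y ⟩
      (suc (e x) ℕ.* suc (e y)) · coeff p (e +δ x +δ y)
        ≈⟨ ×-congˡ (ℕ.*-comm (suc (e x)) (suc (e y))) ⟩
      (suc (e y) ℕ.* suc (e x)) · coeff p (e +δ x +δ y)
        ≈⟨ ×-congʳ (suc (e y) ℕ.* suc (e x)) (reflexive (coeff-ext p λ z → swap (e z) (δ x z) (δ y z))) ⟩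
      (suc (e y) ℕ.* suc (e x)) · coeff p (e +δ y +δ x)
        ≈⟨ twice (x≢y ∘ ≡.sym) ⟨
      coeff (∂ y (∂ x p)) e ∎
      where
      swap : ∀ a b c → a ℕ.+ b ℕ.+ c ≡ a ℕ.+ c ℕ.+ b
      swap a b c = ≡.trans (ℕ.+-assoc a b c)
        (≡.trans (cong (a ℕ.+_) (ℕ.+-comm b c)) (≡.sym (ℕ.+-assoc a c b)))
      twice : ∀ {x y} → x ≢ y → coeff (∂ x (∂ y p)) e ≈ (suc (e x) ℕ.* suc (e y)) · coeff p (e +δ x +δ y)
      twice {x} {y} x≢y = begin
        coeff (∂ x (∂ y p)) e
          ≈⟨ coeff-∂ x (∂ y p) e ⟩
        suc (e x) · coeff (∂ y p) (e +δ x)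
          ≈⟨ ×-congʳ (suc (e x)) (coeff-∂ y p (e +δ x)) ⟩
        suc (e x) · suc ((e +δ x) y) · coeff p (e +δ x +δ y)
          ≈⟨ ×-congʳ (suc (e x)) (×-congˡ (cong suc (+δ-off e x y x≢y))) ⟩
        suc (e x) · suc (e y) · coeff p (e +δ x +δ y)
          ≈⟨ ×-assocˡ _ (suc (e x)) (suc (e y)) ⟩
        (suc (e x) ℕ.* suc (e y)) · coeff p (e +δ x +δ y) ∎

    ∂-combination : ∀ x {n} (a : Fin n → Carrier) (b : Fin n → Poly m) →
      ∂ x (combination a b) ≈ᴾ combination a (∂ x ∘ b)
    ∂-combination x a b e = begin
      coeff (∂ x (combination a b)) e
        ≈⟨ coeff-∂ x (combination a b) e ⟩
      suc (e x) · coeff (combination a b) (e +δ x)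
        ≈⟨ ×-congʳ (suc (e x)) (coeff-combination a b (e +δ x)) ⟩
      suc (e x) · sum (λ i → a i * coeff (b i) (e +δ x))
        ≈⟨ ·-sum (suc (e x)) (λ i → a i * coeff (b i) (e +δ x)) ⟩
      sum (λ i → suc (e x) · (a i * coeff (b i) (e +δ x)))
        ≈⟨ sum-cong-≋ (λ i → ×-comm-* (suc (e x)) (a i) _) ⟨
      sum (λ i → a i * suc (e x) · coeff (b i) (e +δ x))
        ≈⟨ sum-cong-≋ (λ i → *-congˡ (coeff-∂ x (b i) e)) ⟨
      sum (λ i → a i * coeff (∂ x (b i)) e)
        ≈⟨ coeff-combination a (∂ x ∘ b) e ⟨
      coeff (combination a (∂ x ∘ b)) e ∎

    combination-congʳ : ∀ {n} (a : Fin n → Carrier) (b b′ : Fin n → Poly m) →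
      (∀ i → b i ≈ᴾ b′ i) → combination a b ≈ᴾ combination a b′
    combination-congʳ a b b′ b≈b′ e = trans (coeff-combination a b e)
      (trans (sum-cong-≋ λ i → *-congˡ (b≈b′ i e)) (sym (coeff-combination a b′ e)))

    ∂^-cong : ∀ k x (p q : Poly m) → p ≈ᴾ q → ∂^ k x p ≈ᴾ ∂^ k x q
    ∂^-cong zero    x p q p≈q = p≈q
    ∂^-cong (suc k) x p q p≈q = ∂-cong x (∂^ k x p) (∂^ k x q) (∂^-cong k x p q p≈q)

    ∂-∂^-comm : ∀ x k y (p : Poly m) → ∂ x (∂^ k y p) ≈ᴾ ∂^ k y (∂ x p)
    ∂-∂^-comm x zero    y p e = refl
    ∂-∂^-comm x (suc k) y p e = trans (∂-comm x y (∂^ k y p) e)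
      (∂-cong y (∂ x (∂^ k y p)) (∂^ k y (∂ x p)) (∂-∂^-comm x k y p) e)

    -- `∂ x` moves inward past the powers for other variables until it meets the power for `x`,
    -- which it raises by one. As `vars` lists `x` exactly once, nothing else changes.
    ∂-∂ᴱ : ∀ x e (p : Poly m) → ∂ x (∂ᴱ e p) ≈ᴾ ∂ᴱ (e +δ x) p
    ∂-∂ᴱ x e p = go vars vars-unique (∈-vars x)
      where
      D : List (Var m) → Exponent m → Poly m
      D xs e = List.foldr (λ y → ∂^ (e y) y) p xs

      unaffected : ∀ xs → All (x ≢_) xs → D xs e ≡ D xs (e +δ x)
      unaffected []       []           = ≡.refl
      unaffected (y ∷ xs) (x≢y ∷ x∉xs) =
        cong₂ (λ k → ∂^ k y) (≡.sym (+δ-off e x y x≢y)) (unaffected xs x∉xs)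

      go : ∀ xs → Unique xs → x ∈ xs → ∂ x (D xs e) ≈ᴾ D xs (e +δ x)
      go (_ ∷ xs) (x∉xs ∷ _) (here ≡.refl) e₁ = reflexive (cong (λ q → coeff q e₁)
        (cong₂ (λ k → ∂^ k x) (≡.sym (+δ-at e x)) (unaffected xs x∉xs)))
      go (y ∷ xs) (y∉xs ∷ xs!) (there x∈xs) e₁
        -- Uniqueness of the list makes `y` differ from `x`, so the power at `y` is the same on both
        -- sides.
        rewrite +δ-off e x y (λ x≡y → All.lookup y∉xs x∈xs (≡.sym x≡y)) =
        trans (∂-∂^-comm x (e y) y (D xs e) e₁)
          (∂^-cong (e y) y (∂ x (D xs e)) (D xs (e +δ x)) (go xs xs! x∈xs) e₁)

    ∂ᴱ-zero : ∀ (p : Poly m) → ∂ᴱ (λ _ → 0) p ≡ p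
    ∂ᴱ-zero p = go vars
      where
      go : ∀ (xs : List (Var m)) → List.foldr (λ y → ∂^ 0 y) p xs ≡ p
      go []       = ≡.refl
      go (x ∷ xs) = go xs

    -- The span of all partial derivatives.

    PartialsSpan : Poly m → Poly m → Set _
    PartialsSpan f = Span λ e → ∂ᴱ e f

    -- Differentiating a generator gives the generator with exponent shifted by `δ x`, so the same
    -- scalars serve.
    ∂-PartialsSpan : ∀ f x p → PartialsSpan f p → PartialsSpan f (∂ x p)
    ∂-PartialsSpan f x p (n , a , s , p≈) = n , a , (λ i → s i +δ x) , λ e → begin
      coeff (∂ x p) e
        ≈⟨ ∂-cong x p (combination a λ i → ∂ᴱ (s i) f) p≈ e ⟩
      coeff (∂ x (combination a λ i → ∂ᴱ (s i) f)) e
        ≈⟨ ∂-combination x a (λ i → ∂ᴱ (s i) f) e ⟩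
      coeff (combination a λ i → ∂ x (∂ᴱ (s i) f)) e
        ≈⟨ combination-congʳ a _ (λ i → ∂ᴱ (s i +δ x) f) (λ i → ∂-∂ᴱ x (s i) f) e ⟩
      coeff (combination a λ i → ∂ᴱ (s i +δ x) f) e ∎

    f∈PartialsSpan : ∀ f → PartialsSpan f f
    -- The derivative of order zero is `f` itself.
    f∈PartialsSpan f = 1 , (λ _ → 1#) , (λ _ _ → 0) , λ e → begin
      coeff f e                                          ≡⟨ cong (λ q → coeff q e) (∂ᴱ-zero f) ⟨
      coeff (∂ᴱ (λ _ → 0) f) e                           ≈⟨ *-identityˡ _ ⟨
      1# * coeff (∂ᴱ (λ _ → 0) f) e                      ≈⟨ +-identityʳ _ ⟨
      1# * coeff (∂ᴱ (λ _ → 0) f) e + 0#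
        ≈⟨ coeff-combination {1} (λ _ → 1#) (λ _ → ∂ᴱ (λ _ → 0) f) e ⟨
      coeff (combination {n = 1} (λ _ → 1#) λ _ → ∂ᴱ (λ _ → 0) f) e                ∎

    -- Coordinates with respect to a family of polynomials.

    -- Independence is applied to the difference of `a` and `a′`, whose combination vanishes.
    independent⇒injective : ∀ {n} {b : Fin n → Poly m} → LinearlyIndependent b →
      ∀ a a′ → combination a b ≈ᴾ combination a′ b → ∀ i → a i ≈ a′ i
    independent⇒injective {b = b} indep a a′ a≈a′ i = begin
      a i                  ≈⟨ +-identityʳ _ ⟨
      a i + 0#             ≈⟨ +-congˡ (-‿inverseˡ (a′ i)) ⟨
      a i + (- a′ i + a′ i) ≈⟨ +-assoc _ _ _ ⟨
      a i + - a′ i + a′ i  ≈⟨ +-congʳ (indep (λ i → a i + - a′ i) difference i) ⟩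
      0# + a′ i            ≈⟨ +-identityˡ _ ⟩
      a′ i                 ∎
      where
      difference : combination (λ i → a i + - a′ i) b ≈ᴾ []
      difference e = begin
        coeff (combination (λ i → a i + - a′ i) b) e
          ≈⟨ coeff-combination _ b e ⟩
        sum (λ i → (a i + - a′ i) * coeff (b i) e)
          ≈⟨ sum-cong-≋ (λ i → distribʳ (coeff (b i) e) (a i) (- a′ i)) ⟩
        sum (λ i → a i * coeff (b i) e + - a′ i * coeff (b i) e)
          ≈⟨ ∑-distrib-+ (λ i → a i * coeff (b i) e) (λ i → - a′ i * coeff (b i) e) ⟩
        sum (λ i → a i * coeff (b i) e) + sum (λ i → - a′ i * coeff (b i) e)
          ≈⟨ +-congʳ (trans (sym (coeff-combination a b e)) (trans (a≈a′ e) (coeff-combination a′ b e))) ⟩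
        sum (λ i → a′ i * coeff (b i) e) + sum (λ i → - a′ i * coeff (b i) e)
          ≈⟨ ∑-distrib-+ (λ i → a′ i * coeff (b i) e) (λ i → - a′ i * coeff (b i) e) ⟨
        sum (λ i → a′ i * coeff (b i) e + - a′ i * coeff (b i) e)
          ≈⟨ sum-zero (λ i → trans (sym (distribʳ (coeff (b i) e) (a′ i) (- a′ i)))
               (trans (*-congʳ (-‿inverseʳ (a′ i))) (zeroˡ _))) ⟩
        0# ∎

    -- Substituting coordinates multiplies the row vector `a` by the matrix `B`. If `a` is a row of
    -- a matrix, the result is definitionally the same row of its `_⊗_` with `B`.
    combination-⊗ : ∀ {n w} (a : Fin n → Carrier) (B : Fin n → Fin w → Carrier) (b : Fin w → Poly m) →
      combination a (λ i → combination (B i) b) ≈ᴾ combination (λ l → sum λ i → a i * B i l) b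
    combination-⊗ {n} {w} a B b e = begin
      coeff (combination a (λ i → combination (B i) b)) e
        ≈⟨ coeff-combination a (λ i → combination (B i) b) e ⟩
      sum (λ i → a i * coeff (combination (B i) b) e)
        ≈⟨ sum-cong-≋ {n} (λ i → trans (*-congˡ (coeff-combination (B i) b e))
             (*-distribˡ-sum (a i) (λ l → B i l * coeff (b l) e))) ⟩
      sum (λ i → sum λ l → a i * (B i l * coeff (b l) e))
        ≈⟨ ∑-comm (λ i l → a i * (B i l * coeff (b l) e)) ⟩
      sum (λ l → sum λ i → a i * (B i l * coeff (b l) e))
        ≈⟨ sum-cong-≋ {w} (λ l → trans (sum-cong-≋ {n} λ i → sym (*-assoc (a i) (B i l) (coeff (b l) e)))
             (sym (*-distribʳ-sum (coeff (b l) e) (λ i → a i * B i l)))) ⟩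
      sum (λ l → (sum λ i → a i * B i l) * coeff (b l) e)
        ≈⟨ coeff-combination (λ l → sum λ i → a i * B i l) b e ⟨
      coeff (combination (λ l → sum λ i → a i * B i l) b) e ∎

    -- Euler's identity in a single part.

    -- The left side is the coefficient of 𝐱ᵉ in x ∂ₓ g, and x ∂ₓ scales each monomial by its
    -- exponent in x.
    when-∂ : ∀ x (g : Poly m) e → when (e x) (coeff (∂ x g) (e ∸δ x)) ≈ e x · coeff g e
    when-∂ x g e with e x in eq
    ... | zero  = refl
    ... | suc k = begin
      coeff (∂ x g) (e ∸δ x)
        ≈⟨ coeff-∂ x g (e ∸δ x) ⟩
      suc ((e ∸δ x) x) · coeff g (e ∸δ x +δ x)
        ≈⟨ ×-congʳ (suc ((e ∸δ x) x)) (reflexive (coeff-ext g (∸δ-+δ e x eq))) ⟩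
      suc ((e ∸δ x) x) · coeff g e
        -- `(e ∸δ x) x` is `k`, so the successor coming from `coeff-∂` restores `e x`.
        ≈⟨ ×-congˡ (cong suc (cong₂ ℕ._∸_ eq (δ-diag x))) ⟩
      suc k · coeff g e ∎

    sum-· : ∀ {n} (f : Fin n → ℕ) a → sum (λ k → f k · a) ≈ sumᴺ f · a
    sum-· {zero}  f a = refl
    sum-· {suc n} f a = trans (+-congˡ (sum-· (f ∘ suc) a)) (sym (×-homo-+ a (f zero) (sumᴺ (f ∘ suc))))

    -- A disjunction, since whether a coefficient vanishes is undecidable.
    HomogeneousIn : ∀ {n} → (Fin n → Fin d) → Poly m → Set ℓ
    HomogeneousIn t g = ∀ e → coeff g e ≈ 0# ⊎ HasParts t e

    -- A coefficient of the derivative at `e` is a multiple of the coefficient of `g` at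
    -- `e +δ (t zero , k)`, so either alternative for `g` passes on.
    HomogeneousIn-∂ : ∀ {n} {t : Fin (suc n) → Fin d} → Injective _≡_ _≡_ t →
      ∀ g → HomogeneousIn t g → ∀ k → HomogeneousIn (t ∘ suc) (∂ (t zero , k) g)
    HomogeneousIn-∂ {t = t} t-inj g hom k e with hom (e +δ (t zero , k))
    ... | inj₁ ≈0 = inj₁ (trans (coeff-∂ (t zero , k) g e)
      (trans (×-congʳ (suc (e (t zero , k))) ≈0) (·-zero (suc (e (t zero , k))))))
    ... | inj₂ parts = inj₂ (HasParts-tail t-inj e k parts)

    -- Summing x ∂ₓ over one part scales each monomial by its degree in that part. By homogeneity
    -- either this degree is one or the coefficient vanishes, and scaling changes nothing.
    euler : ∀ {n} {t : Fin (suc n) → Fin d} g → HomogeneousIn t g → ∀ e →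
      sum (λ k → when (e (t zero , k)) (coeff (∂ (t zero , k) g) (e ∸δ (t zero , k)))) ≈ coeff g e
    euler {t = t} g hom e = begin
      sum (λ k → when (e (t zero , k)) (coeff (∂ (t zero , k) g) (e ∸δ (t zero , k))))
        ≈⟨ sum-cong-≋ {m (t zero)} (λ k → when-∂ (t zero , k) g e) ⟩
      sum (λ k → e (t zero , k) · coeff g e)
        ≈⟨ sum-· (λ k → e (t zero , k)) (coeff g e) ⟩
      deg (t zero) e · coeff g e
        ≈⟨ degree ⟩
      coeff g e ∎
      where
      degree : deg (t zero) e · coeff g e ≈ coeff g e
      degree with hom e
      ... | inj₁ ≈0 = trans (×-congʳ (deg (t zero) e) ≈0) (trans (·-zero (deg (t zero) e)) (sym ≈0))
      ... | inj₂ (once , _) = trans (×-congˡ (once zero)) (×-homo-1 _)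

    -- The matrices of the derivations on `b`.

    module _ {w} (P : SmABP m w) (b : Fin w → Poly m)
             (∂b≈ : ∀ x i → ∂ x (b i) ≈ᴾ combination (SmABP.A P x i) b) where

      open SmABP P using (A; M)

      -- Coordinates are row vectors, so each differentiation multiplies by `A x` on the right.
      -- Successive derivatives thus build the matrix product in the order in which the program
      -- reads the parts.
      ∂-in-basis : ∀ x (a : Fin w → Carrier) g → g ≈ᴾ combination a b →
        ∂ x g ≈ᴾ combination (λ l → sum λ i → a i * A x i l) b
      ∂-in-basis x a g g≈ e = begin
        coeff (∂ x g) e
          ≈⟨ ∂-cong x g (combination a b) g≈ e ⟩
        coeff (∂ x (combination a b)) e
          ≈⟨ ∂-combination x a b e ⟩
        coeff (combination a (∂ x ∘ b)) e
          ≈⟨ combination-congʳ a (∂ x ∘ b) (λ i → combination (A x i) b) (∂b≈ x) e ⟩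
        coeff (combination a (λ i → combination (A x i) b)) e
          ≈⟨ combination-⊗ a (A x) b e ⟩
        coeff (combination (λ l → sum λ i → a i * A x i l) b) e ∎

      -- Row `i` of either product consists of coordinates of a mixed second derivative of `b i`;
      -- these derivatives agree, and coordinates are unique.
      independent⇒commutative : LinearlyIndependent b → SmABP.Commutative P
      independent⇒commutative indep x y i =
        independent⇒injective indep ((A x MatR.⊗ A y) i) ((A y MatR.⊗ A x) i) λ e → begin
        coeff (combination ((A x MatR.⊗ A y) i) b) e
          ≈⟨ ∂-in-basis y (A x i) (∂ x (b i)) (∂b≈ x i) e ⟨
        coeff (∂ y (∂ x (b i))) e
          ≈⟨ ∂-comm y x (b i) e ⟩
        coeff (∂ x (∂ y (b i))) e
          ≈⟨ ∂-in-basis x (A y i) (∂ y (b i)) (∂b≈ y i) e ⟩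
        coeff (combination ((A y MatR.⊗ A x) i) b) e ∎

      -- Coefficients of the program as sums over paths.

      private
        v₀ : Fin w → Carrier
        v₀ j = coeff (b j) (λ _ → 0)

      -- The coefficient of 𝐱ᵉ in aᵀ M_{t₀} M_{t₁} ⋯ v₀. The start vector and the list of parts are
      -- arguments because the induction changes both.
      pathSum : ∀ {n} → (Fin n → Fin d) → (Fin w → Carrier) → Exponent m → Carrier
      pathSum t a e = sum λ i → sum λ j → a i * coeff (MatP.product (M ∘ t) i j) e * v₀ j

      pathSum-[] : ∀ (t : Fin 0 → Fin d) a e →
        pathSum t a e ≈ sum λ i → a i * coeff {m = m} (const 1#) e * v₀ i
      pathSum-[] t a e = trans
        (sum-cong-≋ {w} λ i → sum-cong-≋ {w} λ j → entry i j)
        (sum-diagonal λ i j → a i * coeff {m = m} (const 1#) e * v₀ j)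
        where
        entry : ∀ i j → a i * coeff (MatP.identity i j) e * v₀ j ≈
                        (if does (i Fin.≟ j) then a i * coeff {m = m} (const 1#) e * v₀ j else 0#)
        entry i j with does (i Fin.≟ j)
        ... | true  = refl
        ... | false = trans (*-congʳ (zeroʳ (a i))) (zeroˡ (v₀ j))

      coeff-M-⊗ : ∀ j₀ (W : MatP.Matrix w) i j e → coeff ((M j₀ MatP.⊗ W) i j) e ≈
        sum λ l → sum λ k → A (j₀ , k) i l * when (e (j₀ , k)) (coeff (W l j) (e ∸δ (j₀ , k)))
      coeff-M-⊗ j₀ W i j e = begin
        coeff ((M j₀ MatP.⊗ W) i j) e
          ≈⟨ coeff-sum (λ l → M j₀ i l *ᴾ W l j) e ⟩
        sum (λ l → coeff (M j₀ i l *ᴾ W l j) e)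
          ≈⟨ sum-cong-≋ {w} (λ l → trans
               (coeff-sum-* (λ k → const (A (j₀ , k) i l) *ᴾ var (j₀ , k)) (W l j) e)
               (sum-cong-≋ {m j₀} λ k → coeff-var-* (A (j₀ , k) i l) (j₀ , k) (W l j) e)) ⟩
        sum (λ l → sum λ k → A (j₀ , k) i l * when (e (j₀ , k)) (coeff (W l j) (e ∸δ (j₀ , k)))) ∎

      -- Reading the first factor amounts to choosing a variable of part `t zero`: its matrix is
      -- absorbed into the start vector and the variable is removed from the exponent.
      pathSum-∷ : ∀ {n} (t : Fin (suc n) → Fin d) a e → pathSum t a e ≈
        sum λ k → when (e (t zero , k))
          (pathSum (t ∘ suc) (λ l → sum λ i → a i * A (t zero , k) i l) (e ∸δ (t zero , k)))
      pathSum-∷ t a e = begin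
        pathSum t a e
          ≈⟨ sum-cong-≋ {w} (λ i → sum-cong-≋ {w} λ j → expand i j) ⟩
        sum (λ i → sum λ j → sum λ l → sum λ k → a i * (A (x k) i l * X k l j) * v₀ j)
          ≈⟨ sum-reverse (λ i j l k → a i * (A (x k) i l * X k l j) * v₀ j) ⟩
        sum (λ k → sum λ l → sum λ j → sum λ i → a i * (A (x k) i l * X k l j) * v₀ j)
          ≈⟨ sum-cong-≋ {m (t zero)} (λ k → contract k) ⟩
        sum (λ k → when (e (x k)) (pathSum (t ∘ suc) (λ l → sum λ i → a i * A (x k) i l) (e ∸δ x k))) ∎
        where
        W : MatP.Matrix w
        W = MatP.product (M ∘ t ∘ suc)

        x : Fin (m (t zero)) → Var m
        x k = t zero , k

        X : Fin (m (t zero)) → Fin w → Fin w → Carrier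
        X k l j = when (e (x k)) (coeff (W l j) (e ∸δ x k))

        expand : ∀ i j → a i * coeff (MatP.product (M ∘ t) i j) e * v₀ j ≈
          sum λ l → sum λ k → a i * (A (x k) i l * X k l j) * v₀ j
        expand i j = begin
          a i * coeff (MatP.product (M ∘ t) i j) e * v₀ j
            ≈⟨ *-congʳ (*-congˡ (coeff-M-⊗ (t zero) W i j e)) ⟩
          a i * (sum λ l → sum λ k → A (x k) i l * X k l j) * v₀ j
            ≈⟨ *-congʳ (trans (*-distribˡ-sum (a i) λ l → sum λ k → A (x k) i l * X k l j)
                 (sum-cong-≋ {w} λ l → *-distribˡ-sum (a i) λ k → A (x k) i l * X k l j)) ⟩
          (sum λ l → sum λ k → a i * (A (x k) i l * X k l j)) * v₀ j
            ≈⟨ trans (*-distribʳ-sum (v₀ j) λ l → sum λ k → a i * (A (x k) i l * X k l j))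
                 (sum-cong-≋ {w} λ l → *-distribʳ-sum (v₀ j) λ k → a i * (A (x k) i l * X k l j)) ⟩
          sum (λ l → sum λ k → a i * (A (x k) i l * X k l j) * v₀ j) ∎

        contract : ∀ k → sum (λ l → sum λ j → sum λ i → a i * (A (x k) i l * X k l j) * v₀ j) ≈
          when (e (x k)) (pathSum (t ∘ suc) (λ l → sum λ i → a i * A (x k) i l) (e ∸δ x k))
        contract k = begin
          sum (λ l → sum λ j → sum λ i → a i * (A (x k) i l * X k l j) * v₀ j)
            ≈⟨ sum-cong-≋ {w} (λ l → sum-cong-≋ {w} λ j → term l j) ⟩
          sum (λ l → sum λ j → when (e (x k)) (T l j))
            ≈⟨ sum-cong-≋ {w} (λ l → when-sum (e (x k)) (T l)) ⟩
          sum (λ l → when (e (x k)) (sum (T l)))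
            ≈⟨ when-sum (e (x k)) (λ l → sum (T l)) ⟩
          when (e (x k)) (sum λ l → sum (T l)) ∎
          where
          aA : Fin w → Carrier
          aA l = sum λ i → a i * A (x k) i l

          T : Fin w → Fin w → Carrier
          T l j = aA l * coeff (W l j) (e ∸δ x k) * v₀ j

          term : ∀ l j → sum (λ i → a i * (A (x k) i l * X k l j) * v₀ j) ≈ when (e (x k)) (T l j)
          term l j = begin
            sum (λ i → a i * (A (x k) i l * X k l j) * v₀ j)
              ≈⟨ *-distribʳ-sum (v₀ j) (λ i → a i * (A (x k) i l * X k l j)) ⟨
            sum (λ i → a i * (A (x k) i l * X k l j)) * v₀ j
              ≈⟨ *-congʳ (sum-cong-≋ {w} λ i → *-assoc (a i) (A (x k) i l) (X k l j)) ⟨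
            sum (λ i → a i * A (x k) i l * X k l j) * v₀ j
              ≈⟨ *-congʳ (*-distribʳ-sum (X k l j) (λ i → a i * A (x k) i l)) ⟨
            aA l * X k l j * v₀ j
              ≈⟨ *-congʳ (when-*ˡ (e (x k)) (aA l) (coeff (W l j) (e ∸δ x k))) ⟩
            when (e (x k)) (aA l * coeff (W l j) (e ∸δ x k)) * v₀ j
              ≈⟨ when-*ʳ (e (x k)) (aA l * coeff (W l j) (e ∸δ x k)) (v₀ j) ⟩
            when (e (x k)) (T l j) ∎

      -- One Euler step replaces `g` by its derivatives in part `t zero`, `a` by their coordinates
      -- and `t` by its tail, which is the recursion of `pathSum-∷`.
      coeff≈pathSum : ∀ {n} (t : Fin n → Fin d) → Injective _≡_ _≡_ t →
        ∀ a g → g ≈ᴾ combination a b → HomogeneousIn t g → ∀ e → coeff g e ≈ pathSum t a e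
      coeff≈pathSum {zero} t t-inj a g g≈ hom e = trans constant (sym (pathSum-[] t a e))
        where
        constant : coeff g e ≈ sum λ i → a i * coeff {m = m} (const 1#) e * v₀ i
        constant with _≟ᴱ_ {m = m} (λ _ → 0) e
        -- With no parts left `g` is constant, so it equals Σᵢ aᵢ bᵢ(0). This is why `v₀` holds the
        -- constant coefficients of the basis.
        ... | yes 0≗e = begin
          coeff g e
            ≡⟨ coeff-ext g 0≗e ⟨
          coeff g (λ _ → 0)
            ≈⟨ g≈ (λ _ → 0) ⟩
          coeff (combination a b) (λ _ → 0)
            ≈⟨ coeff-combination a b (λ _ → 0) ⟩
          sum (λ i → a i * v₀ i)
            ≈⟨ sum-cong-≋ {w} (λ i → *-congʳ (trans
               (*-congˡ (trans (coeff-∷-yes [] 0≗e) (+-identityʳ 1#))) (*-identityʳ (a i)))) ⟨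
          sum (λ i → a i * coeff {m = m} (const 1#) e * v₀ i) ∎
        ... | no 0≇e = trans ≈0 (sym (sum-zero {w} λ i →
            trans (*-congʳ (trans (*-congˡ (coeff-∷-no [] 0≇e)) (zeroʳ (a i)))) (zeroˡ (v₀ i))))
          where
          ≈0 : coeff g e ≈ 0#
          ≈0 with hom e
          ... | inj₁ ≈0    = ≈0
          ... | inj₂ parts = contradiction (HasParts-[] {t = t} parts) 0≇e
      coeff≈pathSum {suc n} t t-inj a g g≈ hom e = begin
        coeff g e
          ≈⟨ euler g hom e ⟨
        sum (λ k → when (e (t zero , k)) (coeff (∂ (t zero , k) g) (e ∸δ (t zero , k))))
          ≈⟨ sum-cong-≋ {m (t zero)} (λ k → when-cong (e (t zero , k))
               (coeff≈pathSum (t ∘ suc) (Fin.suc-injective ∘ t-inj)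
                 (λ l → sum λ i → a i * A (t zero , k) i l) (∂ (t zero , k) g)
                 (∂-in-basis (t zero , k) a g g≈) (HomogeneousIn-∂ t-inj g hom k) (e ∸δ (t zero , k)))) ⟩
        sum (λ k → when (e (t zero , k))
          (pathSum (t ∘ suc) (λ l → sum λ i → a i * A (t zero , k) i l) (e ∸δ (t zero , k))))
          ≈⟨ pathSum-∷ t a e ⟨
        pathSum t a e ∎

    -- Assembling the program.

    coeff-bilinear : ∀ {w} (u : Fin w → Carrier) (W : MatP.Matrix w) (v : Fin w → Carrier) e →
      coeff (MatP.bilinear (const ∘ u) W (const ∘ v)) e ≈ sum λ i → sum λ j → u i * coeff (W i j) e * v j
    coeff-bilinear {w} u W v e = begin
      coeff (MatP.bilinear (const ∘ u) W (const ∘ v)) e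
        ≈⟨ coeff-sum (λ i → sumᴾ λ j → (const (u i) *ᴾ W i j) *ᴾ const (v j)) e ⟩
      sum (λ i → coeff (sumᴾ λ j → (const (u i) *ᴾ W i j) *ᴾ const (v j)) e)
        ≈⟨ sum-cong-≋ {w} (λ i → trans (coeff-sum (λ j → (const (u i) *ᴾ W i j) *ᴾ const (v j)) e)
             (sum-cong-≋ {w} λ j → trans (coeff-*-const (const (u i) *ᴾ W i j) (v j) e)
               (*-congʳ (coeff-const-* (u i) (W i j) e)))) ⟩
      sum (λ i → sum λ j → u i * coeff (W i j) e * v j) ∎

    -- Whether all degrees are one is decidable. If they are not, set-multilinearity only refutes
    -- that the coefficient is nonzero, and stability turns this into vanishing.
    setMultilinear⇒homogeneous : (∀ a → ¬ ¬ (a ≈ 0#) → a ≈ 0#) →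
      ∀ f → IsSetMultilinear f → HomogeneousIn id f
    setMultilinear⇒homogeneous stable f sm e with Fin.all? (λ j → deg j e ℕ.≟ 1)
    ... | yes once = inj₂ (once , λ j j∉ → contradiction ≡.refl (j∉ j))
    ... | no ¬once = inj₁ (stable _ λ f≉0 → ¬once (deg≡1 (sm e f≉0)))

    DPD⇒commutativeSmABP : (∀ a → ¬ ¬ (a ≈ 0#) → a ≈ 0#) →
      ∀ (f : Poly m) → IsSetMultilinear f → ∀ n → DPD f n → HasCommutativeSmABP f n
    DPD⇒commutativeSmABP stable f sm n (b , isBasis) =
      P , independent⇒commutative P b ∂b≈ independent , λ e → trans
        -- The first `id` enumerates the parts in the order of `σ`; the second proves that
        -- enumeration injective.
        (coeff≈pathSum P b ∂b≈ id id u f f≈ (setMultilinear⇒homogeneous stable f sm) e)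
        (sym (coeff-bilinear u (MatP.product (SmABP.M P)) (SmABP.v P) e))
      where
      open IsBasis isBasis
      u : Fin n → Carrier
      u = proj₁ (spanning f (f∈PartialsSpan f))

      f≈ : f ≈ᴾ combination u b
      f≈ = proj₂ (spanning f (f∈PartialsSpan f))

      P : SmABP m n
      P = record
        -- Any order of the parts would do, since the matrices commute.
        { σ = Perm.id
        ; A = λ x i → proj₁ (spanning (∂ x (b i)) (∂-PartialsSpan f x (b i) (members i)))
        ; u = u
        ; v = λ j → coeff (b j) (λ _ → 0)
        }

      ∂b≈ : ∀ x i → ∂ x (b i) ≈ᴾ combination (SmABP.A P x i) b
      ∂b≈ x i = proj₂ (spanning (∂ x (b i)) (∂-PartialsSpan f x (b i) (members i)))

-- Double-negation stability of vanishing in ℝ and ℂ.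

open import Defs hiding (module Polynomials; module Matrices)

-- If |x_N| ≥ ε/2 at an index N beyond which the sequence varies by less than
-- ε/4, then x cannot be null; so comparing the rational |x_N| with ε/2 suffices.
≈ᴿ0-stable : ∀ x → ¬ ¬ (x ≈ᴿ 0ᴿ) → x ≈ᴿ 0ᴿ
≈ᴿ0-stable x ¬¬x≈0 = mk≈ λ ε 0<ε → small ε 0<ε
  where
  half : ℚ → ℚ
  half ε = ½ ℚ.* ε

  half-pos : ∀ {ε} → 0ℚ ℚ.< ε → 0ℚ ℚ.< half ε
  half-pos {ε} 0<ε = subst (ℚ._< half ε) (ℚ.*-zeroʳ ½) (ℚ.*-monoʳ-<-pos ½ 0<ε)

  half+half : ∀ ε → half ε ℚ.+ half ε ≡ ε
  half+half ε = ≡.trans (≡.sym (ℚ.*-distribʳ-+ ε ½ ½)) (ℚ.*-identityˡ ε)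

  triangle : ∀ {ε} p q → ∣ p ℚ.- q ∣ ℚ.< half ε → ∣ q ∣ ℚ.< half ε → ∣ p ∣ ℚ.< ε
  triangle {ε} p q p-q q< = subst (λ z → ∣ z ∣ ℚ.< ε)
    (solve 2 (λ a b → (a :- b) :+ b := a) ≡.refl p q)
    (ℚ.≤-<-trans (ℚ.∣p+q∣≤∣p∣+∣q∣ (p ℚ.- q) q)
      (subst (∣ p ℚ.- q ∣ ℚ.+ ∣ q ∣ ℚ.<_) (half+half ε) (ℚ.+-mono-< p-q q<)))
    where open ℚ.+-*-Solver

  small : ∀ ε → 0ℚ ℚ.< ε → ∃[ N ] ∀ i → N ℕ.≤ i → ∣ seq x i ℚ.- 0ℚ ∣ ℚ.< ε
  small ε 0<ε with cauchy x (half (half ε)) (half-pos (half-pos 0<ε))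
  ... | N , close with ∣ seq x N ∣ ℚ.<? half ε
  ...   | yes xN< = N , λ i N≤i → subst (λ z → ∣ z ∣ ℚ.< ε) (≡.sym (ℚ.+-identityʳ (seq x i)))
    (triangle (seq x i) (seq x N) (ℚ.<-trans (close i N N≤i ℕ.≤-refl) quarter<half) xN<)
    where
    quarter<half : half (half ε) ℚ.< half ε
    quarter<half = subst (half (half ε) ℚ.<_) (half+half (half ε))
      (subst (ℚ._< half (half ε) ℚ.+ half (half ε)) (ℚ.+-identityʳ (half (half ε)))
        (ℚ.+-monoʳ-< (half (half ε)) (half-pos (half-pos 0<ε))))
  ...   | no xN≮ = contradiction
    (λ x≈0 → let K , x< = null x≈0 (half (half ε)) (half-pos (half-pos 0<ε)) in
      -- `N ⊔ K` lies past both thresholds, so two errors below ε/4 bound the term at `N` by ε/2.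
      xN≮ (triangle (seq x N) (seq x (N ℕ.⊔ K))
        (close N (N ℕ.⊔ K) ℕ.≤-refl (ℕ.m≤m⊔n N K))
        (subst (λ z → ∣ z ∣ ℚ.< half (half ε)) (ℚ.+-identityʳ (seq x (N ℕ.⊔ K)))
          (x< (N ℕ.⊔ K) (ℕ.m≤n⊔m N K)))))
    ¬¬x≈0

ℂ-stable : ∀ z → ¬ ¬ (z ≈ᶜ (0ᴿ +i 0ᴿ)) → z ≈ᶜ (0ᴿ +i 0ᴿ)
ℂ-stable (x +i y) ¬¬z≈0 =
  ≈ᴿ0-stable x (λ x≉0 → ¬¬z≈0 (x≉0 ∘ re≈)) ,ᶜ
  ≈ᴿ0-stable y (λ y≉0 → ¬¬z≈0 (y≉0 ∘ im≈))

theorem1p6 : ∀ {d : ℕ} (m : Fin d → ℕ) (f : Poly m) → IsSetMultilinear f → ∀ (n : ℕ) → DPD f n → SmallestCommutativeWidth≤ f n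
-- One program of width `n` gives both halves: it is the witness, and a least width cannot exceed
-- its width.
theorem1p6 m f sm n dpd = (n , ℕ.≤-refl , abp) , λ w (_ , least) → least n abp
  where
  abp : HasCommutativeSmABP f n
  abp = DPD⇒commutativeSmABP ℂ-commutativeRing ℂ-stable f sm n dpd
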